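{- Let $(G,R)$ be an Abelian cyclically ordered group and $C$ a c-convex subgroup of $G$ which is pure in $G$ and linear (so that $C$, with the total order $x\leq y\iff (x=y$ or $R(0,y-x,2(y-x)))$, is a totally ordered group). Then $(G,R)$ is elementarily equivalent, in the language of cyclically ordered groups, to the lexicographic product $(G/C)\overrightarrow{\times}C$, where $G/C$ carries the quotient cyclic order.
   Context: A cyclically ordered group $(G,R)$ (written additively when Abelian) is a group with a ternary relation $R$ that is strict, total (pairwise distinct $x,y,z$ satisfy $R(x,y,z)$ or $R(x,z,y)$), cyclic ($R(x,y,z)\Rightarrow R(y,z,x)$), transitive ($R(x,y,z)\wedge R(y,u,z)\Rightarrow R(x,u,z)$) and translation invariant. It is linear if $R$ comes from a total group order $\leq$ via $R(x,y,z)$ iff $x<y<z$ or $y<z<x$ or $z<x<y$. c-convex subgroups: $G$ itself; and a proper subgroup $H$ with no element of order $2$ such that $h\in H$, $R(-h,0,h)$, $R(0,g,h)$ imply $g\in H$. Every proper c-convex subgroup is linear. $C$ is pure in $G$ if whenever $h\in C$ and $ng=h$ for some $g\in G$, there is $h'\in C$ with $nh'=h$. Quotient cyclic order on $G/C$: $\overline R(\bar x,\bar y,\bar z)$ iff $\bar x,\bar y,\bar z$ pairwise distinct and $R(x',y',z')$ for some (equivalently all) representatives. Lexicographic product of a c.o.g. $(A,R)$ and a totally ordered group $(B,\leq)$: $A\times B$ with $R'((a,b),(a',b'),(a'',b''))$ iff $R(a,a',a'')$, or ($a=a'\neq a''$ and $b<b'$), or ($a\neq a'=a''$ and $b'<b''$),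 or ($a=a''\neq a'$ and $b''<b$), or ($a=a'=a''$ and ($b<b'<b''$ or $b'<b''<b$ or $b''<b<b'$)). -}

module Defs where

open import Level using (Level; _⊔_; suc)
open import Data.Nat using (ℕ; zero) renaming (suc to sucℕ)
open import Data.Fin using (Fin) renaming (zero to fz; suc to fs)
open import Data.Product using (Σ; _×_; _,_; proj₁; proj₂)
open import Data.Sum using (_⊎_)
open import Data.Empty using (⊥)
open import Relation.Nullary using (¬_)
open import Relation.Binary.Core using (Rel)
open import Relation.Binary.Structures using (IsTotalOrder)
open import Algebra.Structures using (IsAbelianGroup)
open import Function.Bundles using (_⇔_)

record CyclicallyOrderedAbelianGroup (c ℓ r : Level) : Set (suc (c ⊔ ℓ ⊔ r)) where
  infixl 6 _+_
  infix  4 _≈_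
  field
    Carrier : Set c
    _≈_     : Rel Carrier ℓ
    _+_     : Carrier → Carrier → Carrier
    0#      : Carrier
    -_      : Carrier → Carrier
    R       : Carrier → Carrier → Carrier → Set r
    isAbelianGroup : IsAbelianGroup _≈_ _+_ 0# -_
    R-resp-≈ : ∀ {x x' y y' z z'} → x ≈ x' → y ≈ y' → z ≈ z' → R x y z → R x' y' z'
    strict      : ∀ {x y z} → R x y z → ¬ (x ≈ y) × ¬ (y ≈ z) × ¬ (x ≈ z)
    total       : ∀ {x y z} → ¬ (x ≈ y) → ¬ (y ≈ z) → ¬ (x ≈ z) → R x y z ⊎ R x z y
    cyclic      : ∀ {x y z} → R x y z → R y z x
    transitive  : ∀ {x y z u} → R x y z → R y u z → R x u z
    translation : ∀ {x y z} g → R x y z → R (g + x) (g + y) (g + z)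

  open IsAbelianGroup isAbelianGroup public

  _·_ : ℕ → Carrier → Carrier
  zero   · g = 0#
  sucℕ n · g = g + (n · g)

module _ {c ℓ r : Level} (G : CyclicallyOrderedAbelianGroup c ℓ r) where
  open CyclicallyOrderedAbelianGroup G

  record IsSubgroup {p : Level} (C : Carrier → Set p) : Set (c ⊔ ℓ ⊔ p) where
    field
      C-resp-≈ : ∀ {x y} → x ≈ y → C x → C y
      C-0      : C 0#
      C-+      : ∀ {x y} → C x → C y → C (x + y)
      C--      : ∀ {x} → C x → C (- x)

  IsCConvex : {p : Level} → (C : Carrier → Set p) → Set (c ⊔ ℓ ⊔ r ⊔ p)
  IsCConvex C =
    (∀ x → C x)
    ⊎ ( ¬ (∀ x → C x)
      × (∀ h → C h → h + h ≈ 0# → h ≈ 0#)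
      × (∀ h g → C h → R (- h) 0# h → R 0# g h → C g))

  IsPure : {p : Level} → (C : Carrier → Set p) → Set (c ⊔ ℓ ⊔ p)
  IsPure C = ∀ (h : Carrier) (n : ℕ) (g : Carrier) → C h → n · g ≈ h →
             Σ Carrier (λ h' → C h' × n · h' ≈ h)

  IsLinear : {p : Level} → (C : Carrier → Set p) → Set (c ⊔ ℓ ⊔ suc r ⊔ p)
  IsLinear C =
    Σ (Rel (Σ Carrier C) r) λ _≤_ →
      let _≈C_ : Rel (Σ Carrier C) ℓ
          _≈C_ = λ x y → proj₁ x ≈ proj₁ y
          _<_ : Rel (Σ Carrier C) (ℓ ⊔ r)
          _<_ = λ x y → (x ≤ y) × ¬ (x ≈C y)
      in IsTotalOrder _≈C_ _≤_
       × (∀ (x y z : Σ Carrier C) (cz : C (proj₁ z + proj₁ x)) (cz' : C (proj₁ z + proj₁ y))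
            → x ≤ y → (proj₁ z + proj₁ x , cz) ≤ (proj₁ z + proj₁ y , cz'))
       × (∀ (x y z : Σ Carrier C) →
            R (proj₁ x) (proj₁ y) (proj₁ z) ⇔
              ((x < y × y < z) ⊎ (y < z × z < x) ⊎ (z < x × x < y)))

data Term (n : ℕ) : Set where
  var  : Fin n → Term n
  zer  : Term n
  plus : Term n → Term n → Term n
  neg  : Term n → Term n

data Formula : ℕ → Set where
  eqF  : ∀ {n} → Term n → Term n → Formula n
  relF : ∀ {n} → Term n → Term n → Term n → Formula n
  falseF : ∀ {n} → Formula n
  impF : ∀ {n} → Formula n → Formula n → Formula n
  andF : ∀ {n} → Formula n → Formula n → Formula n
  allF : ∀ {n} → Formula (sucℕ n) → Formula n

Sentence : Set
Sentence = Formula zero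

record Structure (c ℓ r : Level) : Set (suc (c ⊔ ℓ ⊔ r)) where
  field
    Carrier : Set c
    _≈_     : Carrier → Carrier → Set ℓ
    0#      : Carrier
    _+_     : Carrier → Carrier → Carrier
    -_      : Carrier → Carrier
    R       : Carrier → Carrier → Carrier → Set r

module _ {c ℓ r : Level} (M : Structure c ℓ r) where
  open Structure M

  ext : ∀ {n} → (Fin n → Carrier) → Carrier → Fin (sucℕ n) → Carrier
  ext ρ a fz     = a
  ext ρ a (fs i) = ρ i

  evalT : ∀ {n} → (Fin n → Carrier) → Term n → Carrier
  evalT ρ (var i)    = ρ i
  evalT ρ zer        = 0#
  evalT ρ (plus t u) = evalT ρ t + evalT ρ u
  evalT ρ (neg t)    = - evalT ρ t

  -- Classical (double-negation / Goedel-Gentzen) Tarski semantics.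
  -- The connectives ⊥, →, ∧, ∀ form a complete classical basis.
  Sat : ∀ {n} → (Fin n → Carrier) → Formula n → Set (c ⊔ ℓ ⊔ r)
  Sat ρ (eqF t u)    = Level.Lift (c ⊔ r) (¬ ¬ (evalT ρ t ≈ evalT ρ u))
  Sat ρ (relF t u v) = Level.Lift (c ⊔ ℓ) (¬ ¬ R (evalT ρ t) (evalT ρ u) (evalT ρ v))
  Sat ρ falseF       = Level.Lift (c ⊔ ℓ ⊔ r) ⊥
  Sat ρ (impF φ ψ)   = Sat ρ φ → Sat ρ ψ
  Sat ρ (andF φ ψ)   = Sat ρ φ × Sat ρ ψ
  Sat ρ (allF φ)     = ∀ a → Sat (ext ρ a) φ

  noVars : Fin zero → Carrier
  noVars ()

  _⊨_ : Sentence → Set (c ⊔ ℓ ⊔ r)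
  _⊨_ φ = Sat noVars φ

ElementarilyEquivalent : ∀ {c ℓ r c' ℓ' r'} → Structure c ℓ r → Structure c' ℓ' r' → Set (c ⊔ ℓ ⊔ r ⊔ c' ⊔ ℓ' ⊔ r')
ElementarilyEquivalent M N = ∀ (φ : Sentence) → (M ⊨ φ) ⇔ (N ⊨ φ)

toStructure : ∀ {c ℓ r} → CyclicallyOrderedAbelianGroup c ℓ r → Structure c ℓ r
toStructure G = record
  { Carrier = Carrier ; _≈_ = _≈_ ; 0# = 0# ; _+_ = _+_ ; -_ = -_ ; R = R }
  where open CyclicallyOrderedAbelianGroup G

-- Lexicographic product (G/C) ×→ C, with G/C carrying the quotient cyclic
-- order and C the order  x < y  iff  R(0, y-x, 2(y-x))  (for y ≠ x).
-- G/C is represented by G with equality  a ~ a'  iff  a - a' ∈ C.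

module _ {c ℓ r p : Level} (G : CyclicallyOrderedAbelianGroup c ℓ r)
         (C : CyclicallyOrderedAbelianGroup.Carrier G → Set p)
         (sub : IsSubgroup G C) where
  open CyclicallyOrderedAbelianGroup G
  open IsSubgroup sub

  _~_ : Carrier → Carrier → Set p
  a ~ a' = C (a - a')

  Rq : Carrier → Carrier → Carrier → Set (p ⊔ r)
  Rq a a' a'' = ¬ (a ~ a') × ¬ (a' ~ a'') × ¬ (a ~ a'') × R a a' a''

  _<C_ : Σ Carrier C → Σ Carrier C → Set r
  b <C b' = R 0# (proj₁ b' - proj₁ b) ((proj₁ b' - proj₁ b) + (proj₁ b' - proj₁ b))

  LexR : (Carrier × Σ Carrier C) → (Carrier × Σ Carrier C) → (Carrier × Σ Carrier C) → Set (p ⊔ r)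
  LexR (a , b) (a' , b') (a'' , b'') =
      Rq a a' a''
    ⊎ ((a ~ a') × ¬ (a' ~ a'') × (b <C b'))
    ⊎ (¬ (a ~ a') × (a' ~ a'') × (b' <C b''))
    ⊎ ((a ~ a'') × ¬ (a ~ a') × (b'' <C b))
    ⊎ ((a ~ a') × (a' ~ a'') ×
        (((b <C b') × (b' <C b'')) ⊎ ((b' <C b'') × (b'' <C b)) ⊎ ((b'' <C b) × (b <C b'))))

  lexProduct : Structure (c ⊔ p) (ℓ ⊔ p) (p ⊔ r)
  lexProduct = record
    { Carrier = Carrier × Σ Carrier C
    ; _≈_ = λ x y → (proj₁ x ~ proj₁ y) × (proj₁ (proj₂ x) ≈ proj₁ (proj₂ y))
    ; 0# = 0# , (0# , C-0)
    ; _+_ = λ x y → (proj₁ x + proj₁ y)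
                  , (proj₁ (proj₂ x) + proj₁ (proj₂ y) , C-+ (proj₂ (proj₂ x)) (proj₂ (proj₂ y)))
    ; -_ = λ x → (- proj₁ x) , (- proj₁ (proj₂ x) , C-- (proj₂ (proj₂ x)))
    ; R = LexR
    }

{-# OPTIONS --safe #-}
module Submission where

-- If C had a complement D in G, then G would be the lexicographic product of D ≅ G/C and C, because
-- C is convex. Purity supplies finite approximations of a complement, which suffice for an
-- Ehrenfeucht–Fraïssé game. Call a tuple ζ in G (s, N)-good if t(ζ) ∈ C forces t(ζ) = 0 for terms t
-- of size at most s, and if t(ζ) ∈ d + N·G with d ∈ C forces d ∈ N·C for all terms t. The empty
-- tuple is good by purity. If ζ is (2s², s!·N)-good, then every coset a + C contains a z such that
-- (ζ, z) is (s, N)-good: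
--  * if t(ζ) + j·a ∈ C for some t and j > 0 of size at most s, take z with t(ζ) + j·z = 0; relations
--    of (ζ, z) reduce, after multiplication by j, to relations of ζ, and C is torsion-free;
--  * otherwise take the least j > 0 with t(ζ) + j·a ∈ C + N·G for some t, and z with
--    t(ζ) + j·z ∈ N·G; this j divides N and the coefficient of z in every other such relation.
-- Positions of the game are matched by ρᵢ = ζᵢ + cᵢ in G and (ζᵢ + C, cᵢ) in the product.
-- Excluded middle is available since satisfaction is stable under double negation.

open import Defs
open import Level using (Level; _⊔_; lift; lower)
open import Data.Nat as ℕ using (ℕ; zero; suc; NonZero; _!; _≤_; _<_; z≤n)
import Data.Nat.Properties as ℕₚ
import Data.Nat.Divisibility as Div
open import Data.Nat.DivMod using (_/_; _%_; m≡m%n+[m/n]*n; m%n<n)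
open import Data.Nat.Induction using (<-rec)
open import Data.Fin using (Fin; zero; suc)
open import Data.Vec as Vec using (Vec; []; _∷_; lookup; tabulate)
open import Data.Vec.Properties using (lookup∘tabulate)
open import Data.Product as Product using (Σ; ∃; _×_; _,_; proj₁; proj₂)
open import Data.Sum as Sum using (_⊎_; inj₁; inj₂; [_,_]′)
open import Data.Empty using (⊥-elim)
open import Function using (_∘_)
open import Function.Bundles using (_⇔_; mk⇔; Equivalence)
open import Relation.Nullary using (¬_; Dec; yes; no; ¬¬-excluded-middle; ¬¬-map)
open import Relation.Binary.PropositionalEquality as ≡ using (_≡_)
open import Relation.Binary.Structures using (IsTotalOrder)
open import Algebra.Bundles using (AbelianGroup)
import Algebra.Properties.AbelianGroup as AbelianGroupProperties
import Algebra.Properties.CommutativeMonoid.Mult as Mult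
import Algebra.Properties.CommutativeSemigroup as CommutativeSemigroupProperties
import Relation.Binary.Reasoning.Setoid as SetoidReasoning

-- Terms: sizes, elimination of a variable, coefficients

v₀ : ∀ {n} → Term (1 ℕ.+ n)
v₀ = var zero
v₁ : ∀ {n} → Term (2 ℕ.+ n)
v₁ = var (suc zero)
v₂ : ∀ {n} → Term (3 ℕ.+ n)
v₂ = var (suc (suc zero))
v₃ : ∀ {n} → Term (4 ℕ.+ n)
v₃ = var (suc (suc (suc zero)))

size : ∀ {n} → Term n → ℕ
size (var i)    = 1
size zer        = 0
size (plus t u) = size t ℕ.+ size u
size (neg t)    = size t

multiple : ∀ {n} → ℕ → Term n → Term n
multiple zero    t = zer
multiple (suc k) t = plus t (multiple k t)

size-multiple : ∀ {n} k (t : Term n) → size (multiple k t) ≡ k ℕ.* size t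
size-multiple zero    t = ≡.refl
size-multiple (suc k) t = ≡.cong (size t ℕ.+_) (size-multiple k t)

dropVar : ∀ {n} → Term (suc n) → Term n
dropVar (var zero)    = zer
dropVar (var (suc i)) = var i
dropVar zer           = zer
dropVar (plus t u)    = plus (dropVar t) (dropVar u)
dropVar (neg t)       = neg (dropVar t)

size-dropVar : ∀ {n} (t : Term (suc n)) → size (dropVar t) ≤ size t
size-dropVar (var zero)    = z≤n
size-dropVar (var (suc i)) = ℕₚ.≤-refl
size-dropVar zer           = z≤n
size-dropVar (plus t u)    = ℕₚ.+-mono-≤ (size-dropVar t) (size-dropVar u)
size-dropVar (neg t)       = size-dropVar t

δ : ∀ {n} → Fin n → Fin n → ℕ
δ zero    zero    = 1
δ zero    (suc j) = 0
δ (suc i) zero    = 0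
δ (suc i) (suc j) = δ i j

-- An integer coefficient is kept as a difference of two naturals, since `n · g` exists only for
-- natural `n`. Later identities move the negative part to the other side.
positive negative : ∀ {n} → Term n → Fin n → ℕ
positive (var i)    j = δ i j
positive zer        j = 0
positive (plus t u) j = positive t j ℕ.+ positive u j
positive (neg t)    j = negative t j
negative (var i)    j = 0
negative zer        j = 0
negative (plus t u) j = negative t j ℕ.+ negative u j
negative (neg t)    j = positive t j

positive₀≤size : ∀ {n} (t : Term (suc n)) → positive t zero ≤ size t
negative₀≤size : ∀ {n} (t : Term (suc n)) → negative t zero ≤ size t
positive₀≤size (var zero)    = ℕₚ.≤-refl
positive₀≤size (var (suc i)) = z≤n
positive₀≤size zer           = z≤n
positive₀≤size (plus t u)    = ℕₚ.+-mono-≤ (positive₀≤size t) (positive₀≤size u)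
positive₀≤size (neg t)       = negative₀≤size t
negative₀≤size (var i)       = z≤n
negative₀≤size zer           = z≤n
negative₀≤size (plus t u)    = ℕₚ.+-mono-≤ (negative₀≤size t) (negative₀≤size u)
negative₀≤size (neg t)       = positive₀≤size t

∣! : ∀ {j s} .{{_ : NonZero j}} → j ≤ s → j Div.∣ s !
∣! {suc j} j≤s = Div.∣-trans (Div.m∣m*n (j !)) (Div.m≤n⇒m!∣n! j≤s)

-- If there is no least witness, strong induction refutes every `Q m`. As `Q` need not be decidable,
-- this yields only a double negation.
least : ∀ {q} (Q : ℕ → Set q) {n} → Q n → ¬ ¬ ∃ λ m → Q m × (∀ {k} → k < m → ¬ Q k)
least Q {n} = <-rec (λ n → Q n → ¬ ¬ ∃ λ m → Q m × (∀ {k} → k < m → ¬ Q k))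
  (λ m rec Qm none → none (m , Qm , λ k<m Qk → rec k<m Qk none)) n

-- Abelian group identities and evaluation of terms

module GroupAlgebra {c ℓ r : Level} (G : CyclicallyOrderedAbelianGroup c ℓ r) where
  open CyclicallyOrderedAbelianGroup G

  abelianGroup : AbelianGroup c ℓ
  abelianGroup = record { isAbelianGroup = isAbelianGroup }

  open AbelianGroup abelianGroup using (commutativeMonoid; commutativeSemigroup)
    renaming (setoid to setoid′)
  open AbelianGroupProperties abelianGroup public
    using (⁻¹-involutive; ⁻¹-∙-comm; ε⁻¹≈ε; inverseʳ-unique; inverseˡ-unique; ∙-cancelˡ; ∙-cancelʳ;
           x∙y⁻¹≈ε⇒x≈y; x≈y⇒x∙y⁻¹≈ε)
  open Mult commutativeMonoid using (×-congʳ; ×-homo-+; ×-assocˡ; ×-distrib-+)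
    renaming (_×_ to _⋆_)
  open CommutativeSemigroupProperties commutativeSemigroup using (interchange)
  open SetoidReasoning setoid′

  infixl 5 _▸_
  ⟦_⟧ : ∀ {n} → Term n → (Fin n → Carrier) → Carrier
  ⟦ t ⟧ ρ = evalT (toStructure G) ρ t

  _▸_ : ∀ {n} → (Fin n → Carrier) → Carrier → Fin (suc n) → Carrier
  _▸_ = ext (toStructure G)

  ·≡⋆ : ∀ n x → n · x ≡ n ⋆ x
  ·≡⋆ zero    x = ≡.refl
  ·≡⋆ (suc n) x = ≡.cong (x +_) (·≡⋆ n x)

  ·-congˡ : ∀ n {x y} → x ≈ y → n · x ≈ n · y
  ·-congˡ n {x} {y} x≈y rewrite ·≡⋆ n x | ·≡⋆ n y = ×-congʳ n x≈y

  ·-congʳ : ∀ {m n} x → m ≡ n → m · x ≈ n · x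
  ·-congʳ x ≡.refl = refl

  ·-+ : ∀ m n x → (m ℕ.+ n) · x ≈ m · x + n · x
  ·-+ m n x rewrite ·≡⋆ (m ℕ.+ n) x | ·≡⋆ m x | ·≡⋆ n x = ×-homo-+ x m n

  ·-distrib : ∀ n x y → n · (x + y) ≈ n · x + n · y
  ·-distrib n x y rewrite ·≡⋆ n (x + y) | ·≡⋆ n x | ·≡⋆ n y = ×-distrib-+ x y n

  ·-* : ∀ m n x → (m ℕ.* n) · x ≈ m · (n · x)
  ·-* m n x rewrite ·≡⋆ n x | ·≡⋆ m (n ⋆ x) | ·≡⋆ (m ℕ.* n) x = sym (×-assocˡ x m n)

  ·-neg : ∀ n x → n · (- x) ≈ - (n · x)
  ·-neg zero    x = sym ε⁻¹≈ε
  ·-neg (suc n) x = trans (∙-congˡ (·-neg n x)) (⁻¹-∙-comm x (n · x))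

  ⟦multiple⟧ : ∀ {n} k (t : Term n) ρ → ⟦ multiple k t ⟧ ρ ≡ k · ⟦ t ⟧ ρ
  ⟦multiple⟧ zero    t ρ = ≡.refl
  ⟦multiple⟧ (suc k) t ρ = ≡.cong (⟦ t ⟧ ρ +_) (⟦multiple⟧ k t ρ)

  combination : ∀ {n} → (Fin n → ℕ) → (Fin n → Carrier) → Carrier
  combination {zero}  k ρ = 0#
  combination {suc n} k ρ = k zero · ρ zero + combination (k ∘ suc) (ρ ∘ suc)

  combination-≡ : ∀ {n} {k l : Fin n → ℕ} ρ → (∀ i → k i ≡ l i) →
                  combination k ρ ≈ combination l ρ
  combination-≡ {zero}  ρ k≡l = refl
  combination-≡ {suc n} ρ k≡l =
    ∙-cong (·-congʳ _ (k≡l zero)) (combination-≡ (ρ ∘ suc) (k≡l ∘ suc))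

  combination-0 : ∀ {n} (ρ : Fin n → Carrier) → combination (λ _ → 0) ρ ≈ 0#
  combination-0 {zero}  ρ = refl
  combination-0 {suc n} ρ = trans (identityˡ _) (combination-0 (ρ ∘ suc))

  combination-δ : ∀ {n} i (ρ : Fin n → Carrier) → combination (δ i) ρ ≈ ρ i
  combination-δ zero    ρ =
    trans (∙-cong (identityʳ _) (combination-0 (ρ ∘ suc))) (identityʳ _)
  combination-δ (suc i) ρ = trans (identityˡ _) (combination-δ i (ρ ∘ suc))

  combination-+ : ∀ {n} k l (ρ : Fin n → Carrier) →
    combination (λ i → k i ℕ.+ l i) ρ ≈ combination k ρ + combination l ρ
  combination-+ {zero}  k l ρ = sym (identityˡ _)
  combination-+ {suc n} k l ρ = trans
    (∙-cong (·-+ (k zero) (l zero) _) (combination-+ (k ∘ suc) (l ∘ suc) (ρ ∘ suc)))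
    (interchange _ _ _ _)

  neg-shift : ∀ {x n p} → x + n ≈ p → - x + p ≈ n
  neg-shift {x} {n} {p} e = begin
    - x + p       ≈⟨ ∙-congˡ e ⟨
    - x + (x + n) ≈⟨ assoc _ _ _ ⟨
    - x + x + n   ≈⟨ ∙-congʳ (inverseˡ x) ⟩
    0# + n        ≈⟨ identityˡ n ⟩
    n             ∎

  ⟦⟧-combination : ∀ {n} (t : Term n) ρ →
    ⟦ t ⟧ ρ + combination (negative t) ρ ≈ combination (positive t) ρ
  ⟦⟧-combination (var i) ρ =
    trans (∙-congˡ (combination-0 ρ)) (trans (identityʳ _) (sym (combination-δ i ρ)))
  ⟦⟧-combination zer ρ = identityˡ _
  ⟦⟧-combination (plus t u) ρ = begin
    ⟦ t ⟧ ρ + ⟦ u ⟧ ρ + combination (negative (plus t u)) ρ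
      ≈⟨ ∙-congˡ (combination-+ (negative t) (negative u) ρ) ⟩
    ⟦ t ⟧ ρ + ⟦ u ⟧ ρ + (combination (negative t) ρ + combination (negative u) ρ)
      ≈⟨ interchange _ _ _ _ ⟩
    ⟦ t ⟧ ρ + combination (negative t) ρ + (⟦ u ⟧ ρ + combination (negative u) ρ)
      ≈⟨ ∙-cong (⟦⟧-combination t ρ) (⟦⟧-combination u ρ) ⟩
    combination (positive t) ρ + combination (positive u) ρ
      ≈⟨ combination-+ (positive t) (positive u) ρ ⟨
    combination (positive (plus t u)) ρ ∎
  ⟦⟧-combination (neg t) ρ = neg-shift (⟦⟧-combination t ρ)

  -- Cross-adding the coefficients compares integers without subtraction. For concrete terms both
  -- vectors compute to numerals, so `≡.refl` proves the hypothesis.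
  solve : ∀ {n} (t u : Term n) →
    tabulate (λ i → positive t i ℕ.+ negative u i) ≡
    tabulate (λ i → positive u i ℕ.+ negative t i) →
    (xs : Vec Carrier n) → ⟦ t ⟧ (lookup xs) ≈ ⟦ u ⟧ (lookup xs)
  solve t u t≡u xs = ∙-cancelʳ (nₜ + nᵤ) _ _ (begin
    ⟦ t ⟧ ρ + (nₜ + nᵤ) ≈⟨ assoc _ _ _ ⟨
    ⟦ t ⟧ ρ + nₜ + nᵤ   ≈⟨ ∙-congʳ (⟦⟧-combination t ρ) ⟩
    combination (positive t) ρ + nᵤ
      ≈⟨ combination-+ (positive t) (negative u) ρ ⟨
    combination (λ i → positive t i ℕ.+ negative u i) ρ
      ≈⟨ combination-≡ ρ t≗u ⟩
    combination (λ i → positive u i ℕ.+ negative t i) ρ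
      ≈⟨ combination-+ (positive u) (negative t) ρ ⟩
    combination (positive u) ρ + nₜ ≈⟨ ∙-congʳ (⟦⟧-combination u ρ) ⟨
    ⟦ u ⟧ ρ + nᵤ + nₜ   ≈⟨ assoc _ _ _ ⟩
    ⟦ u ⟧ ρ + (nᵤ + nₜ) ≈⟨ ∙-congˡ (comm _ _) ⟩
    ⟦ u ⟧ ρ + (nₜ + nᵤ) ∎)
    where
    ρ  = lookup xs
    nₜ = combination (negative t) ρ
    nᵤ = combination (negative u) ρ
    t≗u : ∀ i → positive t i ℕ.+ negative u i ≡ positive u i ℕ.+ negative t i
    t≗u i = ≡.trans (≡.sym (lookup∘tabulate _ i))
      (≡.trans (≡.cong (λ v → lookup v i) t≡u) (lookup∘tabulate _ i))

  -- Negates a relation while keeping natural multiples of a variable on both sides.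
  neg-exchange : ∀ {x y n p} → x + n ≈ y + p → - x + p ≈ - y + n
  neg-exchange {x} {y} {n} {p} e = begin
    - x + p               ≈⟨ solve (plus (neg v₀) v₂) (plus (neg v₁) (plus (neg v₀) (plus v₁ v₂)))
                                   ≡.refl (x ∷ y ∷ p ∷ []) ⟩
    - y + (- x + (y + p)) ≈⟨ ∙-congˡ (neg-shift e) ⟩
    - y + n               ∎

  ⟦dropVar⟧ : ∀ {n} (t : Term (suc n)) ρ z →
    ⟦ t ⟧ (ρ ▸ z) + negative t zero · z ≈ ⟦ dropVar t ⟧ ρ + positive t zero · z
  ⟦dropVar⟧ (var zero)    ρ z = trans (identityʳ _) (sym (trans (identityˡ _) (identityʳ _)))
  ⟦dropVar⟧ (var (suc i)) ρ z = refl
  ⟦dropVar⟧ zer           ρ z = refl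
  ⟦dropVar⟧ (plus t u) ρ z = begin
    ⟦ t ⟧ _ + ⟦ u ⟧ _ + (negative t zero ℕ.+ negative u zero) · z
      ≈⟨ ∙-congˡ (·-+ (negative t zero) _ z) ⟩
    ⟦ t ⟧ _ + ⟦ u ⟧ _ + (negative t zero · z + negative u zero · z)
      ≈⟨ interchange _ _ _ _ ⟩
    ⟦ t ⟧ _ + negative t zero · z + (⟦ u ⟧ _ + negative u zero · z)
      ≈⟨ ∙-cong (⟦dropVar⟧ t ρ z) (⟦dropVar⟧ u ρ z) ⟩
    ⟦ dropVar t ⟧ ρ + positive t zero · z + (⟦ dropVar u ⟧ ρ + positive u zero · z)
      ≈⟨ interchange _ _ _ _ ⟩
    ⟦ dropVar t ⟧ ρ + ⟦ dropVar u ⟧ ρ + (positive t zero · z + positive u zero · z)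
      ≈⟨ ∙-congˡ (·-+ (positive t zero) _ z) ⟨
    ⟦ dropVar (plus t u) ⟧ ρ + positive (plus t u) zero · z ∎
  ⟦dropVar⟧ (neg t) ρ z = neg-exchange (⟦dropVar⟧ t ρ z)

-- Torsion-freeness of `C`, and good tuples

module LinearSubgroup {c ℓ r p : Level} (G : CyclicallyOrderedAbelianGroup c ℓ r)
  (C : CyclicallyOrderedAbelianGroup.Carrier G → Set p)
  (sub : IsSubgroup G C) (linear : IsLinear G C) where
  open CyclicallyOrderedAbelianGroup G
  open GroupAlgebra G
  open IsSubgroup sub
  open SetoidReasoning (AbelianGroup.setoid abelianGroup)

  _≤C_ : Σ Carrier C → Σ Carrier C → Set r
  _≤C_ = proj₁ linear

  open IsTotalOrder (proj₁ (proj₂ linear)) using (antisym)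
    renaming (total to ≤C-total; reflexive to ≤C-reflexive; trans to ≤C-trans)

  _≺_ : Σ Carrier C → Σ Carrier C → Set (ℓ ⊔ r)
  x ≺ y = x ≤C y × ¬ (proj₁ x ≈ proj₁ y)

  R⇔≺ : ∀ x y z → R (proj₁ x) (proj₁ y) (proj₁ z) ⇔
                  ((x ≺ y × y ≺ z) ⊎ (y ≺ z × z ≺ x) ⊎ (z ≺ x × x ≺ y))
  R⇔≺ = proj₂ (proj₂ (proj₂ linear))

  C-· : ∀ n {x} → C x → C (n · x)
  C-· zero    Cx = C-0
  C-· (suc n) Cx = C-+ Cx (C-· n Cx)

  ≤C-resp : ∀ {x x′ y y′} → proj₁ x ≈ proj₁ x′ → proj₁ y ≈ proj₁ y′ → x ≤C y → x′ ≤C y′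
  ≤C-resp x≈x′ y≈y′ x≤y = ≤C-trans (≤C-reflexive (sym x≈x′)) (≤C-trans x≤y (≤C-reflexive y≈y′))

  ≤C-shift : ∀ {x y x′ y′} (z : Σ Carrier C) → proj₁ z + proj₁ x ≈ proj₁ x′ →
             proj₁ z + proj₁ y ≈ proj₁ y′ → x ≤C y → x′ ≤C y′
  ≤C-shift {x} {y} z ex ey x≤y =
    ≤C-resp {x = _ , C-+ (proj₂ z) (proj₂ x)} {y = _ , C-+ (proj₂ z) (proj₂ y)} ex ey
    (proj₁ (proj₂ (proj₂ linear)) x y z _ _ x≤y)

  ≺-shift : ∀ {x y x′ y′} (z : Σ Carrier C) → proj₁ z + proj₁ x ≈ proj₁ x′ →
            proj₁ z + proj₁ y ≈ proj₁ y′ → x ≺ y → x′ ≺ y′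
  ≺-shift z ex ey (x≤y , x≉y) = ≤C-shift z ex ey x≤y ,
    λ x′≈y′ → x≉y (∙-cancelˡ (proj₁ z) _ _ (trans ex (trans x′≈y′ (sym ey))))

  -- From 0 ≤ n·x, translation by `x` gives x ≤ (n+1)·x = 0, and antisymmetry finishes.
  nonneg-torsionFree : ∀ n {x} (Cx : C x) → (0# , C-0) ≤C (x , Cx) → suc n · x ≈ 0# → x ≈ 0#
  nonneg-torsionFree n {x} Cx 0≤x nx≈0 = antisym {x , Cx} {0# , C-0}
    (≤C-shift (x , Cx) (identityʳ x) nx≈0 (0≤· n)) 0≤x
    where
    0≤· : ∀ n → (0# , C-0) ≤C (n · x , C-· n Cx)
    0≤· zero    = ≤C-reflexive refl
    0≤· (suc n) = ≤C-trans 0≤x (≤C-shift (x , Cx) (identityʳ x) refl (0≤· n))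

  torsionFree : ∀ n .{{_ : NonZero n}} {x} → C x → n · x ≈ 0# → x ≈ 0#
  torsionFree (suc n) {x} Cx nx≈0 with ≤C-total (0# , C-0) (x , Cx)
  ... | inj₁ 0≤x = nonneg-torsionFree n Cx 0≤x nx≈0
  ... | inj₂ x≤0 = trans (sym (⁻¹-involutive x)) (trans (⁻¹-cong -x≈0) ε⁻¹≈ε)
    where
    -x≈0 : - x ≈ 0#
    -x≈0 = nonneg-torsionFree n (C-- Cx)
      (≤C-shift (- x , C-- Cx) (inverseˡ x) (identityʳ _) x≤0)
      (trans (·-neg (suc n) x) (trans (⁻¹-cong nx≈0) ε⁻¹≈ε))

  ·-cancel : ∀ n .{{_ : NonZero n}} {x y} → C x → C y → n · x ≈ n · y → x ≈ y
  ·-cancel n {x} {y} Cx Cy nx≈ny = x∙y⁻¹≈ε⇒x≈y x y (torsionFree n (C-+ Cx (C-- Cy))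
    (trans (·-distrib n x (- y)) (trans (∙-congˡ (·-neg n y)) (x≈y⇒x∙y⁻¹≈ε nx≈ny))))

  -- The C-part of every decomposition of x in C + M·G lies in M·C. For M = 0: if x ∈ C then x ≈ 0#.
  Splits : ℕ → Carrier → Set (c ⊔ ℓ ⊔ p)
  Splits M x = ∀ {d} h → C d → x ≈ d + M · h → Σ Carrier λ e → C e × M · e ≈ d

  Splits-resp : ∀ {M x y} → x ≈ y → Splits M y → Splits M x
  Splits-resp x≈y Sy h Cd e = Sy h Cd (trans (sym x≈y) e)

  Splits-neg : ∀ {M x} → Splits M (- x) → Splits M x
  Splits-neg {M} {x} S {d} h Cd x≈ with S (- h) (C-- Cd) (begin
    - x               ≈⟨ ⁻¹-cong x≈ ⟩
    - (d + M · h)     ≈⟨ ⁻¹-∙-comm d (M · h) ⟨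
    - d + - (M · h)   ≈⟨ ∙-congˡ (·-neg M h) ⟨
    - d + M · (- h)   ∎)
  ... | e , Ce , Me≈-d = - e , C-- Ce ,
    trans (·-neg M e) (trans (⁻¹-cong Me≈-d) (⁻¹-involutive d))

  -- A decomposition of `x` is multiplied by `k`, and the resulting equation in `C` is divided by
  -- `k` again, by torsion-freeness.
  Splits-cancel : ∀ k .{{_ : NonZero k}} {M x} → Splits (k ℕ.* M) (k · x) → Splits M x
  Splits-cancel k {M} {x} S {d} h Cd x≈ with S h (C-· k Cd) (begin
    k · x                     ≈⟨ ·-congˡ k x≈ ⟩
    k · (d + M · h)           ≈⟨ ·-distrib k d (M · h) ⟩
    k · d + k · (M · h)       ≈⟨ ∙-congˡ (·-* k M h) ⟨
    k · d + (k ℕ.* M) · h     ∎)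
  ... | e , Ce , kMe≈kd = e , Ce , ·-cancel k (C-· M Ce) Cd (trans (sym (·-* k M e)) kMe≈kd)

  -- The coefficient of `z` is n⁺ - n⁻. When it is negative, `t` is negated first, so that only
  -- natural multiples of `z` have to be treated.
  Splits-dropVar : ∀ {n M} (t : Term (suc n)) {ρ z} →
    (∀ t′ j → size t′ ≤ size t → j ≤ size t → Splits M (⟦ t′ ⟧ ρ + j · z)) →
    Splits M (⟦ t ⟧ (ρ ▸ z))
  Splits-dropVar {M = M} t {ρ} {z} S with ℕₚ.≤-total (negative t zero) (positive t zero)
  ... | inj₁ n⁻≤n⁺ = Splits-resp {M} (∙-cancelʳ (negative t zero · z) _ _ (begin
      ⟦ t ⟧ (ρ ▸ z) + n⁻ · z      ≈⟨ ⟦dropVar⟧ t ρ z ⟩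
      y + n⁺ · z                  ≈⟨ ∙-congˡ (·-congʳ z (ℕₚ.m∸n+n≡m n⁻≤n⁺)) ⟨
      y + (n⁺ ℕ.∸ n⁻ ℕ.+ n⁻) · z    ≈⟨ ∙-congˡ (·-+ (n⁺ ℕ.∸ n⁻) n⁻ z) ⟩
      y + ((n⁺ ℕ.∸ n⁻) · z + n⁻ · z) ≈⟨ assoc _ _ _ ⟨
      y + (n⁺ ℕ.∸ n⁻) · z + n⁻ · z  ∎))
    (S (dropVar t) (n⁺ ℕ.∸ n⁻) (size-dropVar t)
      (ℕₚ.≤-trans (ℕₚ.m∸n≤m _ (negative t zero)) (positive₀≤size t)))
    where
    n⁻ = negative t zero
    n⁺ = positive t zero
    y = ⟦ dropVar t ⟧ ρ
  ... | inj₂ n⁺≤n⁻ = Splits-neg {M} (Splits-resp {M} (∙-cancelʳ (n⁺ · z) _ _ (begin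
      - x + n⁺ · z                  ≈⟨ neg-exchange (⟦dropVar⟧ t ρ z) ⟩
      - y + n⁻ · z                  ≈⟨ ∙-congˡ (·-congʳ z (ℕₚ.m∸n+n≡m n⁺≤n⁻)) ⟨
      - y + (n⁻ ℕ.∸ n⁺ ℕ.+ n⁺) · z    ≈⟨ ∙-congˡ (·-+ (n⁻ ℕ.∸ n⁺) n⁺ z) ⟩
      - y + ((n⁻ ℕ.∸ n⁺) · z + n⁺ · z) ≈⟨ assoc _ _ _ ⟨
      - y + (n⁻ ℕ.∸ n⁺) · z + n⁺ · z  ∎))
    (S (neg (dropVar t)) (n⁻ ℕ.∸ n⁺) (size-dropVar t)
      (ℕₚ.≤-trans (ℕₚ.m∸n≤m _ (positive t zero)) (negative₀≤size t))))
    where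
    n⁻ = negative t zero
    n⁺ = positive t zero
    x = ⟦ t ⟧ (ρ ▸ z)
    y = ⟦ dropVar t ⟧ ρ

  -- An approximation to "ρ generates a subgroup that can be enlarged to a complement of C in G".
  Good : ∀ {n} → ℕ → ℕ → (Fin n → Carrier) → Set (c ⊔ ℓ ⊔ p)
  Good s N ρ = (∀ t → size t ≤ s → Splits 0 (⟦ t ⟧ ρ)) × (∀ t → Splits N (⟦ t ⟧ ρ))

  Splits-multiple : ∀ {n M} k .{{_ : NonZero k}} (t : Term n) {ρ} →
    Splits (k ℕ.* M) (⟦ multiple k t ⟧ ρ) → Splits M (⟦ t ⟧ ρ)
  Splits-multiple {M = M} k t {ρ} S =
    Splits-cancel k {M} (≡.subst (Splits (k ℕ.* M)) (⟦multiple⟧ k t ρ) S)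

  -- With N = q·M, the hypothesis is applied to the term q·t and `q` is cancelled. This is why the
  -- congruence half of `Good` puts no bound on the size of terms.
  Splits-divisor : ∀ {n M N} .{{_ : NonZero N}} {ρ : Fin n → Carrier} → M Div.∣ N →
    (∀ t → Splits N (⟦ t ⟧ ρ)) → ∀ t → Splits M (⟦ t ⟧ ρ)
  Splits-divisor {M = M} {{N≢0}} (Div.divides q ≡.refl) S t =
    Splits-multiple {M = M} q {{ℕₚ.m*n≢0⇒m≢0 q {{N≢0}}}} t (S (multiple q t))

  Good-mono : ∀ {n s s′ N N′} .{{_ : NonZero N}} {ρ : Fin n → Carrier} →
    s′ ≤ s → N′ Div.∣ N → Good s N ρ → Good s′ N′ ρ
  Good-mono s′≤s N′∣N (exact , split) =
    (λ t t≤s′ → exact t (ℕₚ.≤-trans t≤s′ s′≤s)) , Splits-divisor N′∣N split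

  Good-exact : ∀ {n s N} {ρ : Fin n → Carrier} → Good s N ρ →
    ∀ t → size t ≤ s → C (⟦ t ⟧ ρ) → ⟦ t ⟧ ρ ≈ 0#
  Good-exact {N = N} (exact , _) t t≤s Ct with exact t t≤s 0# Ct (sym (identityʳ _))
  ... | _ , _ , 0≈t = sym 0≈t

  exactly : ∀ {x} → (C x → x ≈ 0#) → Splits 0 x
  exactly x∈C⇒x≈0 {d} h Cd x≈ = 0# , C-0 , sym (trans (sym x≈d) (x∈C⇒x≈0 (C-resp-≈ (sym x≈d) Cd)))
    where x≈d = trans x≈ (identityʳ d)

  sub-C : ∀ {x e} → C e → C (x - (x - e))
  sub-C {x} {e} Ce = C-resp-≈ (solve v₁ (plus v₀ (neg (plus v₀ (neg v₁)))) ≡.refl (x ∷ e ∷ [])) Ce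

  -- Extension by an element that satisfies a small exact relation

  module ExactExtension {n s M} {ρ : Fin n → Carrier} {z : Carrier}
    (good : Good (s ℕ.* s ℕ.+ s ℕ.* s) (s ! ℕ.* M) ρ) .{{_ : NonZero M}}
    (t₀ : Term n) (t₀≤s : size t₀ ≤ s) (j₀ : ℕ) .{{_ : NonZero j₀}} (j₀≤s : j₀ ≤ s)
    (t₀+j₀z≈0 : ⟦ t₀ ⟧ ρ + j₀ · z ≈ 0#) where

    -- The combination j₀·t - j·t₀, in which `z` cancels because j₀·z = -t₀(ρ). With both
    -- coefficients and both sizes at most `s`, it accounts for the bound 2s².
    eliminate : ℕ → Term n → Term n
    eliminate j t = plus (multiple j₀ t) (multiple j (neg t₀))

    ⟦eliminate⟧ : ∀ j t → j₀ · (⟦ t ⟧ ρ + j · z) ≈ ⟦ eliminate j t ⟧ ρ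
    ⟦eliminate⟧ j t = begin
      j₀ · (⟦ t ⟧ ρ + j · z)            ≈⟨ ·-distrib j₀ _ _ ⟩
      j₀ · ⟦ t ⟧ ρ + j₀ · (j · z)       ≈⟨ ∙-congˡ (·-* j₀ j z) ⟨
      j₀ · ⟦ t ⟧ ρ + (j₀ ℕ.* j) · z     ≈⟨ ∙-congˡ (·-congʳ z (ℕₚ.*-comm j₀ j)) ⟩
      j₀ · ⟦ t ⟧ ρ + (j ℕ.* j₀) · z     ≈⟨ ∙-congˡ (·-* j j₀ z) ⟩
      j₀ · ⟦ t ⟧ ρ + j · (j₀ · z)       ≈⟨ ∙-congˡ (·-congˡ j (inverseʳ-unique _ _ t₀+j₀z≈0)) ⟩
      j₀ · ⟦ t ⟧ ρ + j · (- ⟦ t₀ ⟧ ρ)   ≡⟨ ≡.cong₂ _+_ (⟦multiple⟧ j₀ t ρ) (⟦multiple⟧ j (neg t₀) ρ) ⟨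
      ⟦ eliminate j t ⟧ ρ               ∎

    size-eliminate : ∀ {j} t → size t ≤ s → j ≤ s →
                     size (eliminate j t) ≤ s ℕ.* s ℕ.+ s ℕ.* s
    size-eliminate {j} t t≤s j≤s
      rewrite size-multiple j₀ t | size-multiple j (neg t₀) =
      ℕₚ.+-mono-≤ (ℕₚ.*-mono-≤ j₀≤s t≤s) (ℕₚ.*-mono-≤ j≤s t₀≤s)

    j₀M∣ : j₀ ℕ.* M Div.∣ s ! ℕ.* M
    j₀M∣ = Div.*-monoˡ-∣ M (∣! j₀≤s)

    -- Both halves multiply by `j₀` to eliminate `z` and then cancel `j₀` in `C`. In the congruence
    -- half the modulus grows to j₀·M, which the factor `s !` pays for.
    good-▸ : Good s M (ρ ▸ z)
    good-▸ =
      (λ t t≤s → Splits-dropVar {M = 0} t λ t′ j t′≤t j≤t → exactly λ C[t′+jz] →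
        torsionFree j₀ C[t′+jz] (trans (⟦eliminate⟧ j t′)
          (Good-exact {N = s ! ℕ.* M} good (eliminate j t′)
            (size-eliminate t′ (ℕₚ.≤-trans t′≤t t≤s) (ℕₚ.≤-trans j≤t t≤s))
            (C-resp-≈ (⟦eliminate⟧ j t′) (C-· j₀ C[t′+jz]))))) ,
      (λ t → Splits-dropVar {M = M} t λ t′ j _ _ → Splits-cancel j₀ {M}
        (Splits-resp {j₀ ℕ.* M} (⟦eliminate⟧ j t′)
          (Splits-divisor {{ℕₚ.m*n≢0 (s !) M {{s ℕₚ.!≢0}}}} j₀M∣ (proj₂ good) (eliminate j t′))))

  -- Extension by an element without small exact relations

  module ModularExtension {n s M} .{{_ : NonZero M}} {ρ : Fin n → Carrier} {a : Carrier}
    (good : Good s M ρ)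
    (independent : ∀ t j .{{_ : NonZero j}} → size t ≤ s → j ≤ s → ¬ C (⟦ t ⟧ ρ + j · a))
    where

    -- Leads j: some t(ρ) + j·a lies in C + M·G. The least such j generates the ideal of them.
    Leads : ℕ → Set (c ⊔ ℓ ⊔ p)
    Leads j = NonZero j × Σ (Term n) λ t → Σ Carrier λ d → Σ Carrier λ h →
              C d × ⟦ t ⟧ ρ + j · a ≈ d + M · h

    -- The zero term works, because M·a lies in M·G. So a least leading `j` exists, and by
    -- `remainder≡0` it divides `M`.
    M-leads : Leads M
    -- The instance for `M` is irrelevant; passing through 0 < M rebuilds a proof that can be stored
    -- in `Leads`.
    M-leads = ℕ.>-nonZero (ℕ.>-nonZero⁻¹ M) , zer , 0# , a , C-0 , refl

    module _ (j₁ : ℕ) .{{_ : NonZero j₁}} (t₁ : Term n) {d₁ h₁ : Carrier} (Cd₁ : C d₁)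
      (t₁+j₁a≈ : ⟦ t₁ ⟧ ρ + j₁ · a ≈ d₁ + M · h₁) (minimal : ∀ {k} → k < j₁ → ¬ Leads k) where

      -- Euclidean division of `j` by `j₁`: subtracting q times the leading relation leaves the
      -- remainder as coefficient of `a`.
      reduced : ∀ t j {d h} → ⟦ t ⟧ ρ + j · a ≈ d + M · h →
        let q = j / j₁ in
        ⟦ plus t (multiple q (neg t₁)) ⟧ ρ + (j % j₁) · a ≈ (d - q · d₁) + M · (h - q · h₁)
      reduced t j {d} {h} t+ja≈ = begin
        y + ⟦ multiple q (neg t₁) ⟧ ρ + A  ≡⟨ ≡.cong (λ x → y + x + A) (⟦multiple⟧ q (neg t₁) ρ) ⟩
        y + q · (- ⟦ t₁ ⟧ ρ) + A           ≈⟨ ∙-congʳ (∙-congˡ (·-neg q _)) ⟩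
        y + - Y₁ + A
          -- `Q` is added and subtracted so that both relations appear in full.
          ≈⟨ solve (plus (plus v₀ (neg v₁)) v₂)
                   (plus (plus v₀ (plus v₂ v₃)) (neg (plus v₁ v₃))) ≡.refl (y ∷ Y₁ ∷ A ∷ Q ∷ []) ⟩
        y + (A + Q) - (Y₁ + Q)             ≈⟨ ∙-cong y+A+Q≈ (⁻¹-cong Y₁+Q≈) ⟩
        d + M · h - (q · d₁ + M · (q · h₁))
          ≈⟨ solve (plus (plus v₀ v₁) (neg (plus v₂ v₃)))
                   (plus (plus v₀ (neg v₂)) (plus v₁ (neg v₃))) ≡.refl
                   (d ∷ M · h ∷ q · d₁ ∷ M · (q · h₁) ∷ []) ⟩
        d - q · d₁ + (M · h - M · (q · h₁)) ≈⟨ ∙-congˡ (∙-congˡ (·-neg M _)) ⟨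
        d - q · d₁ + (M · h + M · (- (q · h₁))) ≈⟨ ∙-congˡ (·-distrib M _ _) ⟨
        d - q · d₁ + M · (h - q · h₁)      ∎
        where
        q = j / j₁
        y = ⟦ t ⟧ ρ
        A = (j % j₁) · a
        Q = q · (j₁ · a)
        Y₁ = q · ⟦ t₁ ⟧ ρ
        y+A+Q≈ : y + (A + Q) ≈ d + M · h
        y+A+Q≈ = begin
          y + (A + Q)                            ≈⟨ ∙-congˡ (∙-congˡ (·-* q j₁ a)) ⟨
          y + (A + (q ℕ.* j₁) · a)               ≈⟨ ∙-congˡ (·-+ (j % j₁) _ a) ⟨
          y + (j % j₁ ℕ.+ q ℕ.* j₁) · a          ≈⟨ ∙-congˡ (·-congʳ a (m≡m%n+[m/n]*n j j₁)) ⟨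
          y + j · a                              ≈⟨ t+ja≈ ⟩
          d + M · h                              ∎
        Y₁+Q≈ : Y₁ + Q ≈ q · d₁ + M · (q · h₁)
        Y₁+Q≈ = begin
          Y₁ + Q                                 ≈⟨ ·-distrib q _ _ ⟨
          q · (⟦ t₁ ⟧ ρ + j₁ · a)                ≈⟨ ·-congˡ q t₁+j₁a≈ ⟩
          q · (d₁ + M · h₁)                      ≈⟨ ·-distrib q _ _ ⟩
          q · d₁ + q · (M · h₁)                  ≈⟨ ∙-congˡ (·-* q M h₁) ⟨
          q · d₁ + (q ℕ.* M) · h₁                ≈⟨ ∙-congˡ (·-congʳ h₁ (ℕₚ.*-comm q M)) ⟩
          q · d₁ + (M ℕ.* q) · h₁                ≈⟨ ∙-congˡ (·-* M q h₁) ⟩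
          q · d₁ + M · (q · h₁)                  ∎

      -- A nonzero remainder would lead by `reduced`, contradicting minimality of `j₁`.
      remainder≡0 : ∀ t j {d h} → C d → ⟦ t ⟧ ρ + j · a ≈ d + M · h → j % j₁ ≡ 0
      remainder≡0 t j Cd t+ja≈ = vanishes (j % j₁) (m%n<n j j₁) (reduced t j t+ja≈)
        (C-+ Cd (C-- (C-· (j / j₁) Cd₁)))
        where
        -- The remainder is generalised to a variable so that it can be matched against zero.
        vanishes : ∀ {x h} r → r < j₁ →
          ⟦ plus t (multiple (j / j₁) (neg t₁)) ⟧ ρ + r · a ≈ x + M · h → C x → r ≡ 0
        vanishes zero    _    _  _ = ≡.refl
        vanishes (suc r) r<j₁ eq Cx = ⊥-elim (minimal r<j₁
          (_ , plus t (multiple (j / j₁) (neg t₁)) , _ , _ , Cx , eq))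

      -- Once the remainder is zero, `a` drops out of the reduced relation, and goodness of `ρ`
      -- applies to what is left.
      reduced-splits : ∀ t j {d h} → C d → ⟦ t ⟧ ρ + j · a ≈ d + M · h →
        Σ Carrier λ e → C e × M · e ≈ d - (j / j₁) · d₁
      reduced-splits t j {d} {h} Cd t+ja≈ = proj₂ good (plus t (multiple q (neg t₁)))
        (h - q · h₁) (C-+ Cd (C-- (C-· q Cd₁))) (begin
        ⟦ t′ ⟧ ρ                    ≈⟨ identityʳ _ ⟨
        ⟦ t′ ⟧ ρ + 0#               ≈⟨ ∙-congˡ (·-congʳ a (remainder≡0 t j Cd t+ja≈)) ⟨
        ⟦ t′ ⟧ ρ + (j % j₁) · a     ≈⟨ reduced t j t+ja≈ ⟩
        d - q · d₁ + M · (h - q · h₁) ∎)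
        where
        q = j / j₁
        t′ = plus t (multiple q (neg t₁))

      quotient-exact : ∀ t j {d h} → C d → ⟦ t ⟧ ρ + j · a ≈ d + M · h → j ≡ j / j₁ ℕ.* j₁
      quotient-exact t j Cd t+ja≈ = ≡.trans (m≡m%n+[m/n]*n j j₁)
        (≡.cong (ℕ._+ j / j₁ ℕ.* j₁) (remainder≡0 t j Cd t+ja≈))

      M≡ : M ≡ M / j₁ ℕ.* j₁
      M≡ = quotient-exact zer M {0#} {a} C-0 refl

      -- Since `j₁` divides `M`, the value t₁(ρ) = d₁ + M·h₁ - j₁·a lies in d₁ + j₁·G, and goodness
      -- of `ρ` modulo `j₁` applies.
      root : Σ Carrier λ e → C e × j₁ · e ≈ d₁
      root = Splits-divisor (Div.divides (M / j₁) M≡) (proj₂ good) t₁ (k · h₁ - a) Cd₁ (begin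
        y                           ≈⟨ solve v₀ (plus (plus v₀ v₁) (neg v₁)) ≡.refl (y ∷ j₁ · a ∷ []) ⟩
        y + j₁ · a - j₁ · a         ≈⟨ ∙-congʳ t₁+j₁a≈ ⟩
        d₁ + M · h₁ - j₁ · a        ≈⟨ assoc _ _ _ ⟩
        d₁ + (M · h₁ - j₁ · a)      ≈⟨ ∙-congˡ (∙-congʳ (·-congʳ h₁ (≡.trans M≡ (ℕₚ.*-comm k j₁)))) ⟩
        d₁ + ((j₁ ℕ.* k) · h₁ - j₁ · a) ≈⟨ ∙-congˡ (∙-cong (·-* j₁ k h₁) (sym (·-neg j₁ a))) ⟩
        d₁ + (j₁ · (k · h₁) + j₁ · (- a)) ≈⟨ ∙-congˡ (·-distrib j₁ _ _) ⟨
        d₁ + j₁ · (k · h₁ - a)      ∎)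
        where
        k = M / j₁
        y = ⟦ t₁ ⟧ ρ

      module _ {e : Carrier} (Ce : C e) (j₁e≈d₁ : j₁ · e ≈ d₁) where

        -- The correction by `e` removes the `C`-part of the leading relation: t₁(ρ) + j₁·z = M·h₁.
        z : Carrier
        z = a - e

        +j·a : ∀ y j → y + j · a ≈ y + j · z + j · e
        +j·a y j = begin
          y + j · a               ≈⟨ ∙-congˡ (·-congˡ j (solve v₀ (plus (plus v₀ (neg v₁)) v₁) ≡.refl (a ∷ e ∷ []))) ⟩
          y + j · (z + e)         ≈⟨ ∙-congˡ (·-distrib j z e) ⟩
          y + (j · z + j · e)     ≈⟨ assoc _ _ _ ⟨
          y + j · z + j · e       ∎

        good-▸ : Good s M (ρ ▸ z)
        good-▸ = (λ t t≤s → Splits-dropVar {M = 0} t λ t′ j t′≤t j≤t →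
            exact t′ j (ℕₚ.≤-trans t′≤t t≤s) (ℕₚ.≤-trans j≤t t≤s)) ,
          (λ t → Splits-dropVar {M = M} t λ t′ j _ _ → split t′ j)
          where
          exact : ∀ t j → size t ≤ s → j ≤ s → Splits 0 (⟦ t ⟧ ρ + j · z)
          exact t zero t≤s _ = Splits-resp {0} (identityʳ _) (proj₁ good t t≤s)
          -- `z` and `a` lie in the same coset, so such a relation for `z` would be one for `a`.
          exact t j@(suc _) t≤s j≤s = exactly λ C[t+jz] → ⊥-elim (independent t j t≤s j≤s
            (C-resp-≈ (sym (+j·a (⟦ t ⟧ ρ) j)) (C-+ C[t+jz] (C-· j Ce))))
          split : ∀ t j → Splits M (⟦ t ⟧ ρ + j · z)
          -- Passing from `z` to `a` adds j·e to the `C`-part. As j = q·j₁, this equals q·d₁, which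
          -- is exactly what `reduced-splits` subtracts.
          split t j {d} h Cd t+jz≈ = x , proj₁ (proj₂ splitting) , (begin
            M · x                                   ≈⟨ proj₂ (proj₂ splitting) ⟩
            d + j · e - q · d₁                      ≈⟨ ∙-congʳ (∙-congˡ (·-congʳ e (quotient-exact t j C[d+je] t+ja≈))) ⟩
            d + (q ℕ.* j₁) · e - q · d₁             ≈⟨ ∙-congʳ (∙-congˡ (·-* q j₁ e)) ⟩
            d + q · (j₁ · e) - q · d₁               ≈⟨ ∙-congʳ (∙-congˡ (·-congˡ q j₁e≈d₁)) ⟩
            d + q · d₁ - q · d₁                     ≈⟨ solve (plus (plus v₀ v₁) (neg v₁)) v₀ ≡.refl (d ∷ q · d₁ ∷ []) ⟩
            d                                       ∎)
            where
            q = j / j₁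
            C[d+je] : C (d + j · e)
            C[d+je] = C-+ Cd (C-· j Ce)
            t+ja≈ : ⟦ t ⟧ ρ + j · a ≈ d + j · e + M · h
            t+ja≈ = begin
              ⟦ t ⟧ ρ + j · a           ≈⟨ +j·a _ j ⟩
              ⟦ t ⟧ ρ + j · z + j · e   ≈⟨ ∙-congʳ t+jz≈ ⟩
              d + M · h + j · e         ≈⟨ solve (plus (plus v₀ v₁) v₂) (plus (plus v₀ v₂) v₁) ≡.refl (d ∷ M · h ∷ j · e ∷ []) ⟩
              d + j · e + M · h         ∎
            splitting = reduced-splits t j C[d+je] t+ja≈
            x = proj₁ splitting

  -- The double negation comes from the case distinction on `Dependent` and from `least`;
  -- `Sat-stable` later absorbs it.
  extend : ∀ {n} s M .{{_ : NonZero M}} {ρ : Fin n → Carrier} →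
    Good (s ℕ.* s ℕ.+ s ℕ.* s) (s ! ℕ.* M) ρ → ∀ a →
    ¬ ¬ Σ Carrier λ z → C (a - z) × Good s M (ρ ▸ z)
  extend {n} s M {ρ} good a none = ¬¬-excluded-middle {A = Dependent} λ where
      (yes (t , j , j≢0 , t≤s , j≤s , C[t+ja])) → dependent t j {{j≢0}} t≤s j≤s C[t+ja]
      (no independent) → least (Leads independent) (M-leads independent) λ where
        (j , (j≢0 , t , d , h , Cd , t+ja≈) , minimal) →
          let _ , Ce , je≈d = root independent j {{j≢0}} t Cd t+ja≈ minimal in
          none (_ , sub-C Ce , good-▸ independent j {{j≢0}} t Cd t+ja≈ minimal Ce je≈d)
    where
    Dependent : Set p
    Dependent = Σ (Term n) λ t → Σ ℕ λ j → NonZero j × size t ≤ s × j ≤ s × C (⟦ t ⟧ ρ + j · a)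

    s≤2s² : ∀ s → s ≤ s ℕ.* s ℕ.+ s ℕ.* s
    s≤2s² zero      = z≤n
    s≤2s² s@(suc _) = ℕₚ.≤-trans (ℕₚ.m≤m*n s s) (ℕₚ.m≤m+n (s ℕ.* s) (s ℕ.* s))

    module _ (independent : ¬ Dependent) where
      open ModularExtension {a = a}
        -- The modular extension preserves `s` and `M`, so goodness is lowered to these values
        -- first.
        (Good-mono {{ℕₚ.m*n≢0 (s !) M {{s ℕₚ.!≢0}}}} (s≤2s² s) (Div.n∣m*n (s !)) good)
        (λ t j {{j≢0}} t≤s j≤s C[t+ja] → independent
          (t , j , ℕ.>-nonZero (ℕ.>-nonZero⁻¹ j) , t≤s , j≤s , C[t+ja])) public

    -- With d = t(ρ) + j·a in `C`, the value t(ρ) lies in d + j·G. As j divides `s !`, goodness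
    -- gives `e` in `C` with j·e = d, and z = a - e makes the relation exact.
    dependent : ∀ t j .{{_ : NonZero j}} → size t ≤ s → j ≤ s → ¬ C (⟦ t ⟧ ρ + j · a)
    dependent t j t≤s j≤s C[t+ja]
      with Splits-divisor {{ℕₚ.m*n≢0 (s !) M {{s ℕₚ.!≢0}}}} (Div.∣m⇒∣m*n M (∣! j≤s)) (proj₂ good) t (- a) C[t+ja] t≈
      where
      y = ⟦ t ⟧ ρ
      t≈ : y ≈ y + j · a + j · (- a)
      t≈ = begin
        y                        ≈⟨ solve v₀ (plus (plus v₀ v₁) (neg v₁)) ≡.refl (y ∷ j · a ∷ []) ⟩
        y + j · a - j · a        ≈⟨ ∙-congˡ (·-neg j a) ⟨
        y + j · a + j · (- a)    ∎
    ... | e , Ce , je≈d = none (a - e , sub-C Ce ,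
      ExactExtension.good-▸ good t t≤s j j≤s (begin
        y + j · (a - e)           ≈⟨ ∙-congˡ (trans (·-distrib j a (- e)) (∙-congˡ (·-neg j e))) ⟩
        y + (j · a - j · e)       ≈⟨ assoc _ _ _ ⟨
        y + j · a - j · e         ≈⟨ x≈y⇒x∙y⁻¹≈ε (sym je≈d) ⟩
        0#                        ∎))
      where
      y = ⟦ t ⟧ ρ

  -- A closed term has value 0, so a decomposition 0 = d + M·h says d = M·(-h), and purity moves the
  -- divisor into `C`. The case M = 0 gives the exact half.
  good-[] : IsPure G C → ∀ {s N} → Good s N (noVars (toStructure G))
  good-[] pure {s} {N} = (λ t _ → splits {0} t) , splits {N}
    where
    closed : ∀ t → ⟦ t ⟧ (noVars (toStructure G)) ≈ 0#
    closed zer        = refl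
    closed (plus t u) = trans (∙-cong (closed t) (closed u)) (identityˡ 0#)
    closed (neg t)    = trans (⁻¹-cong (closed t)) ε⁻¹≈ε
    splits : ∀ {M} t → Splits M (⟦ t ⟧ (noVars (toStructure G)))
    splits {M} t {d} h Cd t≈ with pure d M (- h) Cd (begin
      M · (- h)   ≈⟨ ·-neg M h ⟩
      - (M · h)   ≈⟨ inverseˡ-unique d (M · h) (trans (sym t≈) (closed t)) ⟨
      d           ∎)
    ... | e , Ce , Me≈d = e , Ce , Me≈d

-- The cyclic order of `G` in terms of cosets and the order of `C`

module CyclicOrder {c ℓ r p : Level} (G : CyclicallyOrderedAbelianGroup c ℓ r)
  (C : CyclicallyOrderedAbelianGroup.Carrier G → Set p)
  (sub : IsSubgroup G C) (convex : IsCConvex G C) (linear : IsLinear G C) where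
  open CyclicallyOrderedAbelianGroup G
  open GroupAlgebra G
  open IsSubgroup sub
  open LinearSubgroup G C sub linear

  infix 4 _∼_ _≁_
  _∼_ _≁_ : Carrier → Carrier → Set p
  _∼_ = _~_ G C sub
  x ≁ y = ¬ (x ∼ y)

  ≈⇒∼ : ∀ {x y} → x ≈ y → x ∼ y
  ≈⇒∼ x≈y = C-resp-≈ (sym (x≈y⇒x∙y⁻¹≈ε x≈y)) C-0

  ∼-sym : ∀ {x y} → x ∼ y → y ∼ x
  ∼-sym {x} {y} x∼y = C-resp-≈ (solve (neg (plus v₀ (neg v₁))) (plus v₁ (neg v₀)) ≡.refl (x ∷ y ∷ [])) (C-- x∼y)

  ∼-trans : ∀ {x y z} → x ∼ y → y ∼ z → x ∼ z
  ∼-trans {x} {y} {z} x∼y y∼z = C-resp-≈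
    (solve (plus (plus v₀ (neg v₁)) (plus v₁ (neg v₂))) (plus v₀ (neg v₂)) ≡.refl (x ∷ y ∷ z ∷ []))
    (C-+ x∼y y∼z)

  Pos : Carrier → Set r
  Pos h = R 0# h (h + h)

  Pos-resp : ∀ {x y} → x ≈ y → Pos x → Pos y
  Pos-resp x≈y = R-resp-≈ refl x≈y (∙-cong x≈y x≈y)

  R-shift : ∀ g {x y z x′ y′ z′} → g + x ≈ x′ → g + y ≈ y′ → g + z ≈ z′ → R x y z → R x′ y′ z′
  R-shift g ex ey ez Rxyz = R-resp-≈ ex ey ez (translation g Rxyz)

  R-to-0 : ∀ {u v w} → R u v w → R 0# (v - u) (w - u)
  R-to-0 {u} {v} {w} = R-shift (- u) (inverseˡ u) (comm _ _) (comm _ _)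

  rotate : ∀ {x y z} → R x y z → R z x y
  rotate = cyclic ∘ cyclic

  asym : ∀ {x y z} → R x y z → ¬ R x z y
  asym Rxyz Rxzy = proj₁ (strict (transitive Rxyz (rotate Rxzy))) refl

  -- Translating R(0, h, 2h) by -h gives R(-h, 0, h), the form used by c-convexity.
  convex-Pos : ∀ {g h} → C h → Pos h → R 0# g h → C g
  convex-Pos {g} {h} Ch Ph R0gh =
    [ (λ all-C → all-C g) , (λ (_ , _ , closed) → closed h g Ch R-h0h R0gh) ]′ convex
    where
    R-h0h : R (- h) 0# h
    R-h0h = R-shift (- h) (identityʳ _) (inverseˡ h)
      (solve (plus (neg v₀) (plus v₀ v₀)) v₀ ≡.refl (h ∷ [])) Ph

  -- By torsion-freeness 0, h, 2h are distinct. The orientation R(0, 2h, h), translated by -2h and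
  -- rotated, is positivity of -h.
  Pos-total : ∀ {h} → C h → ¬ (h ≈ 0#) → Pos h ⊎ Pos (- h)
  Pos-total {h} Ch h≉0 with total {0#} {h} {h + h} (h≉0 ∘ sym)
    (λ h≈2h → h≉0 (∙-cancelˡ h _ _ (trans (sym h≈2h) (sym (identityʳ h)))))
    (λ 0≈2h → h≉0 (torsionFree 2 Ch (trans (∙-congˡ (identityʳ h)) (sym 0≈2h))))
  ... | inj₁ R0h2h = inj₁ R0h2h
  ... | inj₂ R02hh = inj₂ (cyclic (R-shift (- (h + h))
    (solve (plus (neg (plus v₀ v₀)) zer) (plus (neg v₀) (neg v₀)) ≡.refl (h ∷ []))
    (inverseˡ _) (solve (plus (neg (plus v₀ v₀)) v₀) (neg v₀) ≡.refl (h ∷ [])) R02hh))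

  -- If replacing x by x′ reversed the orientation, y would lie on the arc from x to x′ and z on
  -- the arc from x′ to x; by convexity one of these arcs stays in the coset of x.
  R-resp-∼₁ : ∀ {x x′ y z} → x ∼ x′ → x ≁ y → y ≁ z → x ≁ z → R x y z → R x′ y z
  R-resp-∼₁ {x} {x′} {y} {z} x∼x′ x≁y y≁z x≁z Rxyz
    with total {x′} {y} {z} (x≁y ∘ ∼-trans x∼x′ ∘ ≈⇒∼) (y≁z ∘ ≈⇒∼) (x≁z ∘ ∼-trans x∼x′ ∘ ≈⇒∼)
  ... | inj₁ Rx′yz = Rx′yz
  ... | inj₂ Rx′zy = ⊥-elim ([ x-first , x′-first ]′ (Pos-total (∼-sym x∼x′) x′-x≉0))
    where
    Rx′zx : R x′ z x
    Rx′zx = cyclic (transitive Rxyz (rotate Rx′zy))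
    Rxyx′ : R x y x′
    Rxyx′ = cyclic (transitive Rx′zy (rotate Rxyz))
    x′-x≉0 : ¬ (x′ - x ≈ 0#)
    x′-x≉0 e = asym Rxyz (R-resp-≈ (x∙y⁻¹≈ε⇒x≈y x′ x e) refl refl Rx′zy)
    x-first : ¬ Pos (x′ - x)
    x-first P = x≁y (∼-sym (convex-Pos (∼-sym x∼x′) P (R-to-0 Rxyx′)))
    x′-first : ¬ Pos (- (x′ - x))
    x′-first P = x≁z (∼-trans x∼x′ (∼-sym (convex-Pos x∼x′
      (Pos-resp (solve (neg (plus v₀ (neg v₁))) (plus v₁ (neg v₀)) ≡.refl (x′ ∷ x ∷ [])) P)
      (R-to-0 Rx′zx))))

  -- The points are moved one at a time, each rotated into first place.
  R-resp-∼ : ∀ {x x′ y y′ z z′} → x ∼ x′ → y ∼ y′ → z ∼ z′ →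
             x ≁ y → y ≁ z → x ≁ z → R x y z → R x′ y′ z′
  R-resp-∼ {x} {x′} {y} {y′} {z} {z′} x∼x′ y∼y′ z∼z′ x≁y y≁z x≁z Rxyz =
    cyclic (R-resp-∼₁ z∼z′ z≁x′ x′≁y′ z≁y′
      (cyclic (R-resp-∼₁ y∼y′ y≁z z≁x′ y≁x′
        (cyclic (R-resp-∼₁ x∼x′ x≁y y≁z x≁z Rxyz)))))
    where
    z≁x′ : z ≁ x′
    z≁x′ z∼x′ = x≁z (∼-trans x∼x′ (∼-sym z∼x′))
    y≁x′ : y ≁ x′
    y≁x′ y∼x′ = x≁y (∼-trans x∼x′ (∼-sym y∼x′))
    z≁y′ : z ≁ y′
    z≁y′ z∼y′ = y≁z (∼-trans y∼y′ (∼-sym z∼y′))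
    x′≁y′ : x′ ≁ y′
    x′≁y′ x′∼y′ = y≁x′ (∼-trans y∼y′ (∼-sym x′∼y′))

  -- In the opposite orientation `w` would lie on the arc from `u` to `v`, which convexity keeps
  -- inside their coset.
  Pos⇒R : ∀ {u v w} → u ∼ v → u ≁ w → Pos (v - u) → R u v w
  Pos⇒R {u} {v} {w} u∼v u≁w P with total {u} {v} {w}
    (λ u≈v → proj₁ (strict P) (sym (x≈y⇒x∙y⁻¹≈ε (sym u≈v))))
    (λ v≈w → u≁w (∼-trans u∼v (≈⇒∼ v≈w))) (u≁w ∘ ≈⇒∼)
  ... | inj₁ Ruvw = Ruvw
  ... | inj₂ Ruwv = ⊥-elim (u≁w (∼-sym (convex-Pos (∼-sym u∼v) P (R-to-0 Ruwv))))

  R⇒Pos : ∀ {u v w} → u ∼ v → u ≁ w → R u v w → Pos (v - u)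
  R⇒Pos {u} {v} {w} u∼v u≁w Ruvw
    with Pos-total (∼-sym u∼v) (λ e → proj₁ (strict Ruvw) (sym (x∙y⁻¹≈ε⇒x≈y v u e)))
  ... | inj₁ P = P
  ... | inj₂ P = ⊥-elim (asym Ruvw (cyclic (Pos⇒R (∼-sym u∼v) (u≁w ∘ ∼-trans u∼v)
    (Pos-resp (solve (neg (plus v₀ (neg v₁))) (plus v₁ (neg v₀)) ≡.refl (v ∷ u ∷ [])) P))))

  _⊏_ : Σ Carrier C → Σ Carrier C → Set r
  _⊏_ = _<C_ G C sub

  -- Linearity turns R(0, d, 2d) into three possible chains. Each contains 0 < d or d < 2d, and the
  -- latter translates to the former.
  ⊏⇒≺ : ∀ {b b′} → b ⊏ b′ → b ≺ b′
  ⊏⇒≺ {b , Cb} {b′ , Cb′} P = ≺-shift (b , Cb) (identityʳ b)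
    (solve (plus v₀ (plus v₁ (neg v₀))) v₁ ≡.refl (b ∷ b′ ∷ []))
    (0≺d (Equivalence.to (R⇔≺ (0# , C-0) d 2d) P))
    where
    d 2d : Σ Carrier C
    d  = b′ - b , C-+ Cb′ (C-- Cb)
    2d = _ , C-+ (proj₂ d) (proj₂ d)
    0≺d : ((0# , C-0) ≺ d × d ≺ 2d) ⊎ (d ≺ 2d × 2d ≺ (0# , C-0)) ⊎ (2d ≺ (0# , C-0) × (0# , C-0) ≺ d) →
          (0# , C-0) ≺ d
    0≺d (inj₁ (0≺d , _)) = 0≺d
    0≺d (inj₂ (inj₁ (d≺2d , _))) = ≺-shift (_ , C-- (proj₂ d)) (inverseˡ _)
      (solve (plus (neg v₀) (plus v₀ v₀)) v₀ ≡.refl (proj₁ d ∷ [])) d≺2d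
    0≺d (inj₂ (inj₂ (_ , 0≺d))) = 0≺d

  ≺⇒⊏ : ∀ {b b′} → b ≺ b′ → b ⊏ b′
  ≺⇒⊏ {b , Cb} {b′ , Cb′} b≺b′ = Equivalence.from (R⇔≺ (0# , C-0) d 2d)
    (inj₁ (0≺d , ≺-shift d (identityʳ _) refl 0≺d))
    where
    d 2d : Σ Carrier C
    d  = b′ - b , C-+ Cb′ (C-- Cb)
    2d = _ , C-+ (proj₂ d) (proj₂ d)
    0≺d : (0# , C-0) ≺ d
    0≺d = ≺-shift (_ , C-- Cb) (inverseˡ b) (comm _ _) b≺b′

  -- For q = (a, b), `x` is the representative of the coset of `a` in the approximate complement,
  -- and `u` is the element of `G` matched with `q`.
  record Represents (q : Carrier × Σ Carrier C) (x u : Carrier) : Set (ℓ ⊔ p) where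
    constructor _,_
    field
      coset : proj₁ q ∼ x
      value : u ≈ x + proj₁ (proj₂ q)

  -- Two elements of a true complement of `C` would always satisfy this.
  Rigid : Carrier → Carrier → Set (ℓ ⊔ p)
  Rigid x y = x ∼ y → x ≈ y

  Represents-∼ : ∀ {q x u} → Represents q x u → proj₁ q ∼ u
  Represents-∼ {a , b , Cb} {x} {u} (a∼x , u≈) = ∼-trans a∼x (∼-sym (C-resp-≈
    (trans (solve v₁ (plus (plus v₀ v₁) (neg v₀)) ≡.refl (x ∷ b ∷ [])) (∙-congʳ (sym u≈))) Cb))

  module _ {q₁ q₂ : Carrier × Σ Carrier C} {x₁ x₂ u₁ u₂ : Carrier}
    (ρ₁ : Represents q₁ x₁ u₁) (ρ₂ : Represents q₂ x₂ u₂) where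

    Represents-resp-∼ : proj₁ q₁ ∼ proj₁ q₂ → u₁ ∼ u₂
    Represents-resp-∼ a∼a′ = ∼-trans (∼-sym (Represents-∼ ρ₁)) (∼-trans a∼a′ (Represents-∼ ρ₂))

    Represents-reflects-∼ : u₁ ∼ u₂ → proj₁ q₁ ∼ proj₁ q₂
    Represents-reflects-∼ u∼u′ = ∼-trans (Represents-∼ ρ₁) (∼-trans u∼u′ (∼-sym (Represents-∼ ρ₂)))

    Represents-≈ : Rigid x₁ x₂ → proj₁ q₁ ∼ proj₁ q₂ → x₁ ≈ x₂
    Represents-≈ rigid a∼a′ = rigid
      (∼-trans (∼-sym (Represents.coset ρ₁)) (∼-trans a∼a′ (Represents.coset ρ₂)))

    Represents-difference : Rigid x₁ x₂ → proj₁ q₁ ∼ proj₁ q₂ →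
                            u₂ - u₁ ≈ proj₁ (proj₂ q₂) - proj₁ (proj₂ q₁)
    Represents-difference rigid a∼a′ = trans
      (∙-cong (Represents.value ρ₂) (⁻¹-cong (trans (Represents.value ρ₁) (∙-congʳ (Represents-≈ rigid a∼a′)))))
      (solve (plus (plus v₀ v₂) (neg (plus v₀ v₁))) (plus v₂ (neg v₁)) ≡.refl
        (x₂ ∷ proj₁ (proj₂ q₁) ∷ proj₁ (proj₂ q₂) ∷ []))

    ⊏⇒Pos : Rigid x₁ x₂ → proj₁ q₁ ∼ proj₁ q₂ → proj₂ q₁ ⊏ proj₂ q₂ → Pos (u₂ - u₁)
    ⊏⇒Pos rigid a∼a′ = Pos-resp (sym (Represents-difference rigid a∼a′))

    Pos⇒⊏ : Rigid x₁ x₂ → proj₁ q₁ ∼ proj₁ q₂ → Pos (u₂ - u₁) → proj₂ q₁ ⊏ proj₂ q₂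
    Pos⇒⊏ rigid a∼a′ = Pos-resp (Represents-difference rigid a∼a′)

  module _ {q₁ q₂ q₃ : Carrier × Σ Carrier C} {x₁ x₂ x₃ u₁ u₂ u₃ : Carrier}
    (ρ₁ : Represents q₁ x₁ u₁) (ρ₂ : Represents q₂ x₂ u₂) (ρ₃ : Represents q₃ x₃ u₃)
    (rigid₁₂ : Rigid x₁ x₂) (rigid₂₃ : Rigid x₂ x₃) (rigid₃₁ : Rigid x₃ x₁) where

    private
      rigid₁₃ : Rigid x₁ x₃
      rigid₁₃ x₁∼x₃ = sym (rigid₃₁ (∼-sym x₁∼x₃))
      a₁ = proj₁ q₁
      a₂ = proj₁ q₂
      a₃ = proj₁ q₃
      b₁ = proj₂ q₁
      b₂ = proj₂ q₂
      b₃ = proj₂ q₃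

    -- For distinct cosets the choice of representatives is immaterial. If exactly two cosets agree,
    -- the sign of a difference decides; if all agree, rigidity makes the `x`'s equal and
    -- translation by `x₁` reduces to `C`.
    LexR⇒R : LexR G C sub q₁ q₂ q₃ → R u₁ u₂ u₃
    LexR⇒R (inj₁ (a₁≁a₂ , a₂≁a₃ , a₁≁a₃ , Ra)) =
      R-resp-∼ (Represents-∼ ρ₁) (Represents-∼ ρ₂) (Represents-∼ ρ₃) a₁≁a₂ a₂≁a₃ a₁≁a₃ Ra
    LexR⇒R (inj₂ (inj₁ (a₁∼a₂ , a₂≁a₃ , b₁⊏b₂))) =
      Pos⇒R (Represents-resp-∼ ρ₁ ρ₂ a₁∼a₂)
        (a₂≁a₃ ∘ ∼-trans (∼-sym a₁∼a₂) ∘ Represents-reflects-∼ ρ₁ ρ₃)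
        (⊏⇒Pos ρ₁ ρ₂ rigid₁₂ a₁∼a₂ b₁⊏b₂)
    LexR⇒R (inj₂ (inj₂ (inj₁ (a₁≁a₂ , a₂∼a₃ , b₂⊏b₃)))) = rotate
      (Pos⇒R (Represents-resp-∼ ρ₂ ρ₃ a₂∼a₃)
        (a₁≁a₂ ∘ ∼-sym ∘ Represents-reflects-∼ ρ₂ ρ₁)
        (⊏⇒Pos ρ₂ ρ₃ rigid₂₃ a₂∼a₃ b₂⊏b₃))
    LexR⇒R (inj₂ (inj₂ (inj₂ (inj₁ (a₁∼a₃ , a₁≁a₂ , b₃⊏b₁))))) = cyclic
      (Pos⇒R (Represents-resp-∼ ρ₃ ρ₁ (∼-sym a₁∼a₃))
        (a₁≁a₂ ∘ ∼-trans a₁∼a₃ ∘ Represents-reflects-∼ ρ₃ ρ₂)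
        (⊏⇒Pos ρ₃ ρ₁ rigid₃₁ (∼-sym a₁∼a₃) b₃⊏b₁))
    LexR⇒R (inj₂ (inj₂ (inj₂ (inj₂ (a₁∼a₂ , a₂∼a₃ , b-cyclic))))) =
      R-shift x₁ (sym (Represents.value ρ₁))
        (trans (∙-congʳ (Represents-≈ ρ₁ ρ₂ rigid₁₂ a₁∼a₂)) (sym (Represents.value ρ₂)))
        (trans (∙-congʳ (Represents-≈ ρ₁ ρ₃ rigid₁₃ (∼-trans a₁∼a₂ a₂∼a₃))) (sym (Represents.value ρ₃)))
        (Equivalence.from (R⇔≺ b₁ b₂ b₃) (to-≺ b-cyclic))
      where
      to-≺ : ((b₁ ⊏ b₂ × b₂ ⊏ b₃) ⊎ (b₂ ⊏ b₃ × b₃ ⊏ b₁) ⊎ (b₃ ⊏ b₁ × b₁ ⊏ b₂)) →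
             ((b₁ ≺ b₂ × b₂ ≺ b₃) ⊎ (b₂ ≺ b₃ × b₃ ≺ b₁) ⊎ (b₃ ≺ b₁ × b₁ ≺ b₂))
      to-≺ = Sum.map (Product.map ⊏⇒≺ ⊏⇒≺) (Sum.map (Product.map ⊏⇒≺ ⊏⇒≺) (Product.map ⊏⇒≺ ⊏⇒≺))

    R⇒LexR : R u₁ u₂ u₃ → ¬ ¬ LexR G C sub q₁ q₂ q₃
    R⇒LexR Ru none =
      ¬¬-excluded-middle {A = a₁ ∼ a₂} λ a₁∼a₂? →
      ¬¬-excluded-middle {A = a₂ ∼ a₃} λ a₂∼a₃? →
      ¬¬-excluded-middle {A = a₁ ∼ a₃} λ a₁∼a₃? → none (cases a₁∼a₂? a₂∼a₃? a₁∼a₃?)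
      where
      to-⊏ : ((b₁ ≺ b₂ × b₂ ≺ b₃) ⊎ (b₂ ≺ b₃ × b₃ ≺ b₁) ⊎ (b₃ ≺ b₁ × b₁ ≺ b₂)) →
             ((b₁ ⊏ b₂ × b₂ ⊏ b₃) ⊎ (b₂ ⊏ b₃ × b₃ ⊏ b₁) ⊎ (b₃ ⊏ b₁ × b₁ ⊏ b₂))
      to-⊏ = Sum.map (Product.map ≺⇒⊏ ≺⇒⊏) (Sum.map (Product.map ≺⇒⊏ ≺⇒⊏) (Product.map ≺⇒⊏ ≺⇒⊏))
      unshift : ∀ {x u b} → u ≈ x + b → x₁ ≈ x → - x₁ + u ≈ b
      unshift {x} {u} {b} u≈ x₁≈x = trans (∙-cong (⁻¹-cong x₁≈x) u≈)
        (solve (plus (neg v₀) (plus v₀ v₁)) v₁ ≡.refl (x ∷ b ∷ []))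
      cases : Dec (a₁ ∼ a₂) → Dec (a₂ ∼ a₃) → Dec (a₁ ∼ a₃) → LexR G C sub q₁ q₂ q₃
      cases (yes a₁∼a₂) (yes a₂∼a₃) _ = inj₂ (inj₂ (inj₂ (inj₂ (a₁∼a₂ , a₂∼a₃ ,
        to-⊏ (Equivalence.to (R⇔≺ b₁ b₂ b₃) (R-shift (- x₁)
          (unshift (Represents.value ρ₁) refl)
          (unshift (Represents.value ρ₂) (Represents-≈ ρ₁ ρ₂ rigid₁₂ a₁∼a₂))
          (unshift (Represents.value ρ₃) (Represents-≈ ρ₁ ρ₃ rigid₁₃ (∼-trans a₁∼a₂ a₂∼a₃)))
          Ru))))))
      cases (yes a₁∼a₂) (no a₂≁a₃) _ = inj₂ (inj₁ (a₁∼a₂ , a₂≁a₃ ,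
        Pos⇒⊏ ρ₁ ρ₂ rigid₁₂ a₁∼a₂ (R⇒Pos (Represents-resp-∼ ρ₁ ρ₂ a₁∼a₂)
          (a₂≁a₃ ∘ ∼-trans (∼-sym a₁∼a₂) ∘ Represents-reflects-∼ ρ₁ ρ₃) Ru)))
      cases (no a₁≁a₂) (yes a₂∼a₃) _ = inj₂ (inj₂ (inj₁ (a₁≁a₂ , a₂∼a₃ ,
        Pos⇒⊏ ρ₂ ρ₃ rigid₂₃ a₂∼a₃ (R⇒Pos (Represents-resp-∼ ρ₂ ρ₃ a₂∼a₃)
          (a₁≁a₂ ∘ ∼-sym ∘ Represents-reflects-∼ ρ₂ ρ₁) (cyclic Ru)))))
      cases (no a₁≁a₂) (no a₂≁a₃) (yes a₁∼a₃) = inj₂ (inj₂ (inj₂ (inj₁ (a₁∼a₃ , a₁≁a₂ ,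
        Pos⇒⊏ ρ₃ ρ₁ rigid₃₁ (∼-sym a₁∼a₃) (R⇒Pos (Represents-resp-∼ ρ₃ ρ₁ (∼-sym a₁∼a₃))
          (a₁≁a₂ ∘ ∼-trans a₁∼a₃ ∘ Represents-reflects-∼ ρ₃ ρ₂) (rotate Ru))))))
      cases (no a₁≁a₂) (no a₂≁a₃) (no a₁≁a₃) = inj₁ (a₁≁a₂ , a₂≁a₃ , a₁≁a₃ ,
        R-resp-∼ (∼-sym (Represents-∼ ρ₁)) (∼-sym (Represents-∼ ρ₂)) (∼-sym (Represents-∼ ρ₃))
          (a₁≁a₂ ∘ Represents-reflects-∼ ρ₁ ρ₂) (a₂≁a₃ ∘ Represents-reflects-∼ ρ₂ ρ₃)
          (a₁≁a₃ ∘ Represents-reflects-∼ ρ₁ ρ₃) Ru)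

-- Stability of satisfaction, and the goodness a formula demands

Sat-stable : ∀ {c ℓ r n} (M : Structure c ℓ r) {ρ : Fin n → Structure.Carrier M} (φ : Formula n) →
             ¬ ¬ Sat M ρ φ → Sat M ρ φ
-- Atoms are doubly negated by definition, and implication, conjunction and ∀ pass a double negation
-- inward.
Sat-stable M (eqF t u)    ¬¬s = lift (λ t≉u → ¬¬s (λ s → lower s t≉u))
Sat-stable M (relF t u v) ¬¬s = lift (λ ¬R → ¬¬s (λ s → lower s ¬R))
Sat-stable M falseF       ¬¬s = lift (¬¬s lower)
Sat-stable M (impF φ ψ)   ¬¬s = λ Sφ → Sat-stable M ψ (¬¬-map (λ s → s Sφ) ¬¬s)
Sat-stable M (andF φ ψ)   ¬¬s =
  Sat-stable M φ (¬¬-map proj₁ ¬¬s) , Sat-stable M ψ (¬¬-map proj₂ ¬¬s)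
Sat-stable M (allF φ)     ¬¬s = λ a → Sat-stable M φ (¬¬-map (λ s → s a) ¬¬s)

-- `bound` and `modulus` are the `s` and `N` for which goodness suffices to transfer the formula.
-- Binary connectives combine the demands of both parts; a quantifier adds the loss incurred in
-- `extend`.
bound : ∀ {n} → Formula n → ℕ
bound (eqF t u)    = size t ℕ.+ size u
bound (relF t u v) = size t ℕ.+ size u ℕ.+ size v
bound falseF       = 0
bound (impF φ ψ)   = bound φ ℕ.+ bound ψ
bound (andF φ ψ)   = bound φ ℕ.+ bound ψ
bound (allF φ)     = bound φ ℕ.* bound φ ℕ.+ bound φ ℕ.* bound φ

modulus : ∀ {n} → Formula n → ℕ
modulus (eqF t u)    = 1
modulus (relF t u v) = 1
modulus falseF       = 1
modulus (impF φ ψ)   = modulus φ ℕ.* modulus ψ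
modulus (andF φ ψ)   = modulus φ ℕ.* modulus ψ
modulus (allF φ)     = bound φ ! ℕ.* modulus φ

modulus≢0 : ∀ {n} (φ : Formula n) → NonZero (modulus φ)
modulus≢0 (eqF t u)    = _
modulus≢0 (relF t u v) = _
modulus≢0 falseF       = _
modulus≢0 (impF φ ψ)   = ℕₚ.m*n≢0 _ _ {{modulus≢0 φ}} {{modulus≢0 ψ}}
modulus≢0 (andF φ ψ)   = ℕₚ.m*n≢0 _ _ {{modulus≢0 φ}} {{modulus≢0 ψ}}
modulus≢0 (allF φ)     = ℕₚ.m*n≢0 _ _ {{bound φ ℕₚ.!≢0}} {{modulus≢0 φ}}

-- The back-and-forth argument

module Transfer {c ℓ r p : Level} (G : CyclicallyOrderedAbelianGroup c ℓ r)
  (C : CyclicallyOrderedAbelianGroup.Carrier G → Set p)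
  (sub : IsSubgroup G C) (convex : IsCConvex G C) (linear : IsLinear G C) where
  open CyclicallyOrderedAbelianGroup G
  open GroupAlgebra G
  open IsSubgroup sub
  open LinearSubgroup G C sub linear
  open CyclicOrder G C sub convex linear

  Lex : Structure (c ⊔ p) (ℓ ⊔ p) (p ⊔ r)
  Lex = lexProduct G C sub

  Matching : ∀ {n} → (Fin n → Carrier) → (Fin n → Carrier × Σ Carrier C) → (Fin n → Carrier) →
             Set (ℓ ⊔ p)
  Matching ρ σ ζ = ∀ i → Represents (σ i) (ζ i) (ρ i)

  module _ {n} {ρ : Fin n → Carrier} {σ : Fin n → Carrier × Σ Carrier C} {ζ : Fin n → Carrier}
    (matching : Matching ρ σ ζ) where

    Matching-⟦⟧ : ∀ t → Represents (evalT Lex σ t) (⟦ t ⟧ ζ) (⟦ t ⟧ ρ)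
    Matching-⟦⟧ (var i) = matching i
    Matching-⟦⟧ zer = ≈⇒∼ refl , sym (identityʳ 0#)
    Matching-⟦⟧ (plus t u) with Matching-⟦⟧ t | Matching-⟦⟧ u
    ... | t∼ , t≈ | u∼ , u≈ =
      C-resp-≈ (solve (plus (plus v₀ (neg v₁)) (plus v₂ (neg v₃))) (plus (plus v₀ v₂) (neg (plus v₁ v₃)))
        ≡.refl (_ ∷ _ ∷ _ ∷ _ ∷ [])) (C-+ t∼ u∼) ,
      trans (∙-cong t≈ u≈) (solve (plus (plus v₀ v₁) (plus v₂ v₃)) (plus (plus v₀ v₂) (plus v₁ v₃))
        ≡.refl (_ ∷ _ ∷ _ ∷ _ ∷ []))
    Matching-⟦⟧ (neg t) with Matching-⟦⟧ t
    ... | t∼ , t≈ =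
      C-resp-≈ (solve (neg (plus v₀ (neg v₁))) (plus (neg v₀) (neg (neg v₁))) ≡.refl (_ ∷ _ ∷ [])) (C-- t∼) ,
      trans (⁻¹-cong t≈) (sym (⁻¹-∙-comm _ _))

    Matching-▸ : ∀ {a q z} → Represents q z a → Matching (ρ ▸ a) (ext Lex σ q) (ζ ▸ z)
    Matching-▸ m zero    = m
    Matching-▸ m (suc i) = matching i

  -- Exactness is applied to the term t - u, whose size is the sum of the two; this fixes `bound` on
  -- atoms.
  Good-rigid : ∀ {n s N} {ζ : Fin n → Carrier} → Good s N ζ →
    ∀ t u → size t ℕ.+ size u ≤ s → Rigid (⟦ t ⟧ ζ) (⟦ u ⟧ ζ)
  Good-rigid {N = N} good t u t+u≤s t∼u =
    x∙y⁻¹≈ε⇒x≈y _ _ (Good-exact {N = N} good (plus t (neg u)) t+u≤s t∼u)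

  Good-both : ∀ {n} (φ ψ : Formula n) {ζ : Fin n → Carrier} →
    Good (bound φ ℕ.+ bound ψ) (modulus φ ℕ.* modulus ψ) ζ →
    Good (bound φ) (modulus φ) ζ × Good (bound ψ) (modulus ψ) ζ
  Good-both φ ψ good =
    Good-mono {N′ = modulus φ} (ℕₚ.m≤m+n _ (bound ψ)) (Div.m∣m*n (modulus ψ)) good ,
    Good-mono {N′ = modulus ψ} (ℕₚ.m≤n+m _ (bound φ)) (Div.n∣m*n (modulus φ)) good
    where instance _ = modulus≢0 (impF φ ψ)

  transfer : ∀ {n} (φ : Formula n) {ρ σ ζ} → Matching ρ σ ζ → Good (bound φ) (modulus φ) ζ →
             Sat (toStructure G) ρ φ ⇔ Sat Lex σ φ
  transfer (eqF t u) {ρ} {σ} {ζ} m good =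
    mk⇔ (λ s → lift (¬¬-map to (lower s))) (λ s → lift (¬¬-map from (lower s)))
    where
    rigid = Good-rigid {N = 1} good t u ℕₚ.≤-refl
    mₜ = Matching-⟦⟧ m t
    mᵤ = Matching-⟦⟧ m u
    to : ⟦ t ⟧ ρ ≈ ⟦ u ⟧ ρ → Structure._≈_ Lex (evalT Lex σ t) (evalT Lex σ u)
    to t≈u = a∼a′ , sym (x∙y⁻¹≈ε⇒x≈y _ _ (trans
        (sym (Represents-difference mₜ mᵤ rigid a∼a′)) (x≈y⇒x∙y⁻¹≈ε (sym t≈u))))
      where a∼a′ = Represents-reflects-∼ mₜ mᵤ (≈⇒∼ t≈u)
    from : Structure._≈_ Lex (evalT Lex σ t) (evalT Lex σ u) → ⟦ t ⟧ ρ ≈ ⟦ u ⟧ ρ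
    from (a∼a′ , b≈b′) = trans (Represents.value mₜ) (trans
      (∙-cong (Represents-≈ mₜ mᵤ rigid a∼a′) b≈b′) (sym (Represents.value mᵤ)))
  transfer (relF t u v) m good =
    mk⇔ (λ s → lift (λ none → lower s (λ Ruvw → R⇒LexR mₜ mᵤ mᵥ tu uv vt Ruvw none)))
        (λ s → lift (¬¬-map (LexR⇒R mₜ mᵤ mᵥ tu uv vt) (lower s)))
    where
    mₜ = Matching-⟦⟧ m t
    mᵤ = Matching-⟦⟧ m u
    mᵥ = Matching-⟦⟧ m v
    tu = Good-rigid {N = 1} good t u (ℕₚ.m≤m+n _ _)
    uv = Good-rigid {N = 1} good u v (ℕₚ.+-monoˡ-≤ (size v) (ℕₚ.m≤n+m _ (size t)))
    vt = Good-rigid {N = 1} good v t (ℕₚ.≤-trans (ℕₚ.≤-reflexive (ℕₚ.+-comm (size v) _))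
      (ℕₚ.+-monoˡ-≤ (size v) (ℕₚ.m≤m+n _ (size u))))
  transfer falseF m good = mk⇔ (λ s → lift (lower s)) (λ s → lift (lower s))
  transfer (impF φ ψ) m good = mk⇔
    (λ s x → Equivalence.to ψ⇔ (s (Equivalence.from φ⇔ x)))
    (λ s x → Equivalence.from ψ⇔ (s (Equivalence.to φ⇔ x)))
    where
    goods = Good-both φ ψ good
    φ⇔ = transfer φ m (proj₁ goods)
    ψ⇔ = transfer ψ m (proj₂ goods)
  transfer (andF φ ψ) m good = mk⇔
    (Product.map (Equivalence.to φ⇔) (Equivalence.to ψ⇔))
    (Product.map (Equivalence.from φ⇔) (Equivalence.from ψ⇔))
    where
    goods = Good-both φ ψ good
    φ⇔ = transfer φ m (proj₁ goods)
    ψ⇔ = transfer ψ m (proj₂ goods)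
  transfer (allF φ) m good = mk⇔
    -- A move q = (a, b) in the product is answered by z + b in `G`, with `z` a good representative
    -- of the coset of `a`.
    (λ s q → Sat-stable Lex φ (¬¬-map
      (λ (z , a∼z , good′) → Equivalence.to
        (transfer φ (Matching-▸ m (a∼z , refl)) good′) (s (z + proj₁ (proj₂ q))))
      (extend (bound φ) (modulus φ) {{modulus≢0 φ}} good (proj₁ q))))
    -- A move `a` in `G` is answered by (z, a - z); membership of a - z in `C` is what `extend`
    -- provides.
    (λ s a → Sat-stable (toStructure G) φ (¬¬-map
      (λ (z , a∼z , good′) → Equivalence.from
        (transfer φ (Matching-▸ m (≈⇒∼ refl ,
          solve v₀ (plus v₁ (plus v₀ (neg v₁))) ≡.refl (a ∷ z ∷ []))) good′)
        (s (z , a - z , a∼z)))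
      (extend (bound φ) (modulus φ) {{modulus≢0 φ}} good a)))

theorem6p1 : {c ℓ r p : Level} (G : CyclicallyOrderedAbelianGroup c ℓ r)
    (C : CyclicallyOrderedAbelianGroup.Carrier G → Set p)
    (sub : IsSubgroup G C) → IsCConvex G C → IsPure G C → IsLinear G C →
    ElementarilyEquivalent (toStructure G) (lexProduct G C sub)
theorem6p1 G C sub convex pure linear φ =
  -- The game starts from empty tuples, whose goodness is where purity enters.
  Transfer.transfer G C sub convex linear φ {ζ = noVars (toStructure G)} (λ ())
    (LinearSubgroup.good-[] G C sub linear pure {bound φ} {modulus φ})
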